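{- Let $n,a,b,c$ be nonnegative integers with $0<a<2^{n+1}$, $b2^{n+1}+a\le c2^n$, and $c\ge 1$ odd. Then $$\nu_2\big(S(c2^n,\,b2^{n+1}+a)\big)\ \ge\ s_2(a)-1.$$
   Context: $S(n,k)$ denotes the Stirling number of the second kind: the number of partitions of an $n$-element set into exactly $k$ nonempty subsets. $\nu_2(m)$ denotes the 2-adic valuation of $m$ (the exponent of the highest power of 2 dividing $m$). $s_2(m)$ denotes the sum of the binary digits of the nonnegative integer $m$. -}

module Defs where

open import Data.Bool.Properties using () renaming (_≟_ to _≟ᵇ_)
open import Data.Bool.Base using (if_then_else_)
open import Data.Digit using (toDigits)
open import Data.Fin.Base using (toℕ)
open import Data.Fin.Subset using (Subset; inside; outside; Nonempty; Empty; _∩_; ⋃; ⊤)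
open import Data.Fin.Subset.Properties using (nonempty?)
open import Data.List.Base using (List; []; _∷_; _++_; map; filter; length)
open import Data.List.Relation.Unary.All using (All; all?)
open import Data.List.Relation.Unary.AllPairs using (AllPairs; allPairs?)
open import Data.Nat.Base using (ℕ; zero; suc; _^_)
open import Data.Nat.Divisibility using (_∣?_)
open import Data.Nat.ListAction using (sum)
open import Data.Product.Base using (_×_; proj₁)
open import Data.Vec.Base using ([]; _∷_)
open import Data.Vec.Properties using (≡-dec)
open import Relation.Binary.PropositionalEquality using (_≡_)
open import Relation.Nullary.Decidable using (Dec; does; ¬?; _×-dec_)

-- Every subset of an n-element set, listed exactly once.
subsets : (n : ℕ) → List (Subset n)
subsets zero    = [] ∷ []
subsets (suc n) = map (outside ∷_) (subsets n) ++ map (inside ∷_) (subsets n)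

-- The sublists of length k, chosen by position. When the argument has no
-- repetitions, each k-element set of its entries occurs exactly once.
choose : {A : Set} → ℕ → List A → List (List A)
choose zero    _        = [] ∷ []
choose (suc k) []       = []
choose (suc k) (x ∷ xs) = map (x ∷_) (choose k xs) ++ choose (suc k) xs

Disjoint : {n : ℕ} → Subset n → Subset n → Set
Disjoint p q = Empty (p ∩ q)

IsPartition : {n : ℕ} → List (Subset n) → Set
IsPartition F = All Nonempty F × AllPairs Disjoint F × ⋃ F ≡ ⊤

isPartition? : {n : ℕ} (F : List (Subset n)) → Dec (IsPartition F)
isPartition? F =
  all? nonempty? F
  ×-dec allPairs? (λ p q → ¬? (nonempty? (p ∩ q))) F
  ×-dec ≡-dec _≟ᵇ_ (⋃ F) ⊤

-- Stirling number of the second kind: an unordered partition into k blocks is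
-- a k-element set of subsets, represented by its unique listing in the order
-- of `subsets n`.
S : ℕ → ℕ → ℕ
S n k = length (filter isPartition? (choose k (subsets n)))

-- The largest e ≤ bound with 2 ^ e ∣ m.
maxExponent : (bound m : ℕ) → ℕ
maxExponent zero    m = 0
maxExponent (suc e) m = if does (2 ^ suc e ∣? m) then suc e else maxExponent e m

-- For m > 0, 2 ^ e ∣ m forces e < 2 ^ e ≤ m, so the bound m loses nothing.
-- The value ν₂ 0 = 0 is a convention.
ν₂ : ℕ → ℕ
ν₂ m = maxExponent m m

s₂ : ℕ → ℕ
s₂ m = sum (map toℕ (proj₁ (toDigits 2 m)))

{-# OPTIONS --safe #-}
module Submission where

-- As Δᵏ xᴺ at 0 equals k! S(N, k), and k! is 2^(k - s₂ k) times an odd number, the claim for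
-- N = c 2ⁿ and L = n + 1 says that 2 xᴺ belongs to the set B of the functions f : ℕ → ℤ such
-- that 2ᵏ divides 2^(s₂ ⌊k / 2ᴸ⌋) Δᵏ f for all k. By the Leibniz rule and Kummer's theorem B
-- is closed under products. Put z = x^(2ⁿ), and let o be the (idempotent) indicator of the odd
-- numbers. The differences of z, taken modulo one more power of 2, show that 2 z, 2 z o and
-- z² - o are in B. Hence if 2 f and 2 f o are in B, then so are
-- 2 f z² = 2 f o + 2 f (z² - o) and 2 f z² o = 2 f o + 2 f o (z² - o),
-- and induction from f = z reaches all odd powers of z.

-- For k = b 2ᴸ + a the weight in `B` gives away s₂ b of the s₂ k = s₂ b + s₂ a factors of 2 that k!
-- lacks, so exactly s₂ a of them must come from 2 S(N, k); the extra 2 costs the final 1. The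
-- obstacle is that Δᵏ⁺¹ z is only 2ᵏ times an integer, one factor 2 short of what `B` asks while
-- the weight is still 1. From 2ᴸ on the weight is even and makes up for it, so all depends on the
-- parities of the first 2ᴸ quotients. For z² these are all odd, hence z² itself is outside `B`; but
-- the quotients for o are ±1, and subtracting o corrects every parity at once. The odd quotients of
-- z² stop precisely at 2ⁿ⁺¹, which dictates L = n + 1. A second obstacle is that `S` counts
-- families in a list of subsets. Removing a point from the ground set may leave an empty block, so
-- the count is generalised: each uncovered point receives a weight x. This x becomes the argument
-- at which the differences of the power are taken.

open import Defs

-- Binary digit sums, Legendre's formula and Kummer's theorem.

module BinaryDigits where
  open import Data.Digit using (fromDigits; toDigits)
  open import Data.Fin.Base using (Fin; zero; suc; toℕ)
  open import Data.List.Base using (List; []; _∷_; map)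
  open import Data.Nat.Base
  open import Data.Nat.Divisibility
  open import Data.Nat.DivMod
    using (_divMod_; result; +-distrib-/-∣ˡ; m*n/n≡m; m<n⇒m/n≡0; m%n<n; m≡m%n+[m/n]*n)
  open import Data.Nat.ListAction using (sum)
  open import Data.Nat.Properties
  open import Data.Nat.Tactic.RingSolver using (solve-∀)
  open import Data.Product.Base using (∃; ∃₂; _×_; _,_; proj₁; proj₂)
  open import Relation.Binary.PropositionalEquality
  open import Relation.Nullary using (Dec; yes; no; contradiction)
  open ≡-Reasoning

  digitSum : List (Fin 2) → ℕ
  digitSum ds = sum (map toℕ ds)

  digitSum-zero : ∀ ds → fromDigits ds ≡ 0 → digitSum ds ≡ 0
  digitSum-zero []          _  = refl
  digitSum-zero (zero ∷ ds) eq = digitSum-zero ds (m*n≡0⇒m≡0 _ 2 eq)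

  m*2≢1+n*2 : ∀ m n → m * 2 ≢ suc (n * 2)
  m*2≢1+n*2 m n eq = even≢odd m n (subst₂ (λ x y → x ≡ suc y) (*-comm m 2) (*-comm n 2) eq)

  digitSum≡0 : ∀ ds → digitSum ds ≡ 0 → fromDigits ds ≡ 0
  digitSum≡0 []          _  = refl
  digitSum≡0 (zero ∷ ds) eq = cong (_* 2) (digitSum≡0 ds eq)

  halve : ∀ n → ∃₂ λ (d : Fin 2) m → n ≡ toℕ d + m * 2
  halve n with n divMod 2
  ... | result q d eq = d , q , eq

  -- `s₂` reads the particular list returned by `toDigits`. Independence of the list allows
  -- recursion on any digit list of the number.
  digitSum-unique : ∀ ds es → fromDigits ds ≡ fromDigits es → digitSum ds ≡ digitSum es
  digitSum-unique []              es              eq = sym (digitSum-zero es (sym eq))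
  digitSum-unique (d ∷ ds)        []              eq = digitSum-zero (d ∷ ds) eq
  digitSum-unique (zero ∷ ds)     (zero ∷ es)     eq =
    digitSum-unique ds es (*-cancelʳ-≡ _ _ 2 eq)
  digitSum-unique (zero ∷ ds)     (suc zero ∷ es) eq =
    contradiction eq (m*2≢1+n*2 (fromDigits ds) (fromDigits es))
  digitSum-unique (suc zero ∷ ds) (zero ∷ es)     eq =
    contradiction (sym eq) (m*2≢1+n*2 (fromDigits es) (fromDigits ds))
  digitSum-unique (suc zero ∷ ds) (suc zero ∷ es) eq =
    cong suc (digitSum-unique ds es (*-cancelʳ-≡ _ _ 2 (suc-injective eq)))

  opaque
    -- Sealing s₂ keeps the type checker from unfolding its well-founded recursion.
    σ : ℕ → ℕ
    σ = s₂

    σ≡s₂ : ∀ n → σ n ≡ s₂ n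
    σ≡s₂ _ = refl

    σ-fromDigits : ∀ ds → σ (fromDigits ds) ≡ digitSum ds
    σ-fromDigits ds = digitSum-unique (proj₁ (toDigits 2 (fromDigits ds))) ds
      (proj₂ (toDigits 2 (fromDigits ds)))

    digits : ∀ n → ∃ λ (ds : List (Fin 2)) → fromDigits ds ≡ n
    digits = toDigits 2

  σ-digit : ∀ (d : Fin 2) m → σ (toℕ d + m * 2) ≡ toℕ d + σ m
  σ-digit d m with digits m
  ... | ds , refl = trans (σ-fromDigits (d ∷ ds)) (cong (toℕ d +_) (sym (σ-fromDigits ds)))

  σ-positive : ∀ n → 0 < n → 0 < σ n
  σ-positive n 0<n with digits n
  ... | ds , refl = n≢0⇒n>0 λ eq →
    >⇒≢ 0<n (digitSum≡0 ds (trans (sym (σ-fromDigits ds)) eq))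

  σ-zero : σ 0 ≡ 0
  σ-zero = σ-fromDigits []

  σ-one : σ 1 ≡ 1
  σ-one = σ-fromDigits (suc zero ∷ [])

  σ-split : ∀ L b a → a < 2 ^ L → σ (b * 2 ^ L + a) ≡ σ b + σ a
  σ-split zero b zero _ = begin
    σ (b * 1 + 0)  ≡⟨ cong σ (trans (+-identityʳ _) (*-identityʳ b)) ⟩
    σ b            ≡⟨ +-identityʳ _ ⟨
    σ b + 0        ≡⟨ cong (σ b +_) σ-zero ⟨
    σ b + σ 0      ∎
  σ-split zero b (suc a) (s≤s ())
  σ-split (suc L) b a a<2^L with halve a
  ... | d , q , refl = begin
    σ (b * (2 * 2 ^ L) + (toℕ d + q * 2))  ≡⟨ cong σ (rearrange b (2 ^ L) (toℕ d) q) ⟩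
    σ (toℕ d + (b * 2 ^ L + q) * 2)        ≡⟨ σ-digit d _ ⟩
    toℕ d + σ (b * 2 ^ L + q)              ≡⟨ cong (toℕ d +_) (σ-split L b q q<2^L) ⟩
    toℕ d + (σ b + σ q)                    ≡⟨ swap (toℕ d) (σ b) (σ q) ⟩
    σ b + (toℕ d + σ q)                    ≡⟨ cong (σ b +_) (σ-digit d q) ⟨
    σ b + σ (toℕ d + q * 2)                ∎
    where
    rearrange : ∀ b p d q → b * (2 * p) + (d + q * 2) ≡ d + (b * p + q) * 2
    rearrange = solve-∀
    swap : ∀ x y z → x + (y + z) ≡ y + (x + z)
    swap = solve-∀
    q<2^L : q < 2 ^ L
    q<2^L = *-cancelʳ-< 2 q (2 ^ L)
      (≤-<-trans (m≤n+m _ (toℕ d)) (subst (toℕ d + q * 2 <_) (*-comm 2 (2 ^ L)) a<2^L))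

  σ-pow : ∀ L → σ (2 ^ L) ≡ 1
  σ-pow L = begin
    σ (2 ^ L)          ≡⟨ cong σ (trans (+-identityʳ _) (*-identityˡ _)) ⟨
    σ (1 * 2 ^ L + 0)  ≡⟨ σ-split L 1 0 (m^n>0 2 L) ⟩
    σ 1 + σ 0          ≡⟨ cong₂ _+_ σ-one σ-zero ⟩
    1                  ∎

  σ-pow+ : ∀ L r → r < 2 ^ L → σ (2 ^ L + r) ≡ suc (σ r)
  σ-pow+ L r r<2^L = begin
    σ (2 ^ L + r)      ≡⟨ cong (λ p → σ (p + r)) (*-identityˡ (2 ^ L)) ⟨
    σ (1 * 2 ^ L + r)  ≡⟨ σ-split L 1 r r<2^L ⟩
    σ 1 + σ r          ≡⟨ cong (_+ σ r) σ-one ⟩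
    suc (σ r)          ∎

  Odd : ℕ → Set
  Odd n = ∃ λ m → n ≡ 1 + m * 2

  odd-1 : Odd 1
  odd-1 = 0 , refl

  odd-* : ∀ {m n} → Odd m → Odd n → Odd (m * n)
  odd-* (u , refl) (v , refl) = u + v + u * v * 2 , lemma u v
    where
    lemma : ∀ u v → (1 + u * 2) * (1 + v * 2) ≡ 1 + (u + v + u * v * 2) * 2
    lemma = solve-∀

  odd-factor : ∀ m {n} → Odd (m * n) → Odd m
  odd-factor m {n} (u , eq) with halve m
  ... | zero , q , refl = contradiction (trans (sym (comm q n)) eq) (m*2≢1+n*2 (q * n) u)
    where
    comm : ∀ q n → q * 2 * n ≡ q * n * 2
    comm = solve-∀
  ... | suc zero , q , refl = q , refl

  -- With q = 1 + u * 2, the product is m * u * 2 + m, so m is even as soon as the product is; halve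
  -- m and repeat.
  odd-cancel-∣ : ∀ e m {q} → Odd q → 2 ^ e ∣ m * q → 2 ^ e ∣ m
  odd-cancel-∣ zero    m _ _ = 1∣ m
  odd-cancel-∣ (suc e) m {q} odd@(u , refl) 2^e∣mq with ∣m+n∣m⇒∣n even-mq (n∣m*n (m * u))
    where
    expand : ∀ m u → m * (1 + u * 2) ≡ m * u * 2 + m
    expand = solve-∀
    even-mq : 2 ∣ m * u * 2 + m
    even-mq = subst (2 ∣_) (expand m u) (∣-trans (m∣m*n (2 ^ e)) 2^e∣mq)
  ... | divides m′ refl = subst (2 ^ suc e ∣_) (*-comm 2 m′) (*-monoʳ-∣ 2 (odd-cancel-∣ e m′ odd
          (*-cancelˡ-∣ 2 (subst (2 ^ suc e ∣_) (shift m′ q) 2^e∣mq))))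
    where
    shift : ∀ m q → m * 2 * q ≡ 2 * (m * q)
    shift = solve-∀

  -- Incrementing m clears its trailing ones and sets the next digit, so m + 1 has 2-adic valuation
  -- σ m + 1 - σ (m + 1). The powers stand on both sides to avoid subtraction.
  σ-suc : ∀ (ds : List (Fin 2)) → let m = fromDigits ds in
           ∃ λ q → Odd q × 2 ^ σ (suc m) * suc m ≡ 2 ^ suc (σ m) * q
  σ-suc [] = 1 , odd-1 , cong₂ (λ a b → 2 ^ a * b)
    (trans σ-one (cong suc (sym σ-zero))) refl
  σ-suc (zero ∷ ds) = suc (m * 2) , (m , refl) , cong (λ e → 2 ^ e * suc (m * 2))
    (trans (σ-digit (suc zero) m) (cong suc (sym (σ-digit zero m))))
    where m = fromDigits ds
  σ-suc (suc zero ∷ ds) with σ-suc ds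
  ... | q , odd-q , eq = q , odd-q , (begin
    2 ^ σ (suc m * 2) * (suc m * 2)  ≡⟨ cong (λ e → 2 ^ e * (suc m * 2)) (σ-digit zero (suc m)) ⟩
    2 ^ σ (suc m) * (suc m * 2)      ≡⟨ left (2 ^ σ (suc m)) (suc m) ⟩
    2 * (2 ^ σ (suc m) * suc m)      ≡⟨ cong (2 *_) eq ⟩
    2 * (2 ^ suc (σ m) * q)          ≡⟨ *-assoc 2 (2 ^ suc (σ m)) q ⟨
    2 ^ suc (suc (σ m)) * q          ≡⟨ cong (λ e → 2 ^ suc e * q) (σ-digit (suc zero) m) ⟨
    2 ^ suc (σ (1 + m * 2)) * q      ∎)
    where
    m = fromDigits ds
    left : ∀ x y → x * (y * 2) ≡ 2 * (x * y)
    left = solve-∀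

  -- The valuations given by `σ-suc` telescope over the factors of n !, to n - σ n.
  legendre : ∀ n → ∃ λ q → Odd q × 2 ^ σ n * n ! ≡ 2 ^ n * q
  legendre zero    = 1 , odd-1 , cong (λ e → 2 ^ e * 1) σ-zero
  legendre (suc n) with legendre n
                      | subst (λ m → ∃ λ q → Odd q × 2 ^ σ (suc m) * suc m ≡ 2 ^ suc (σ m) * q)
                          (proj₂ (digits n)) (σ-suc (proj₁ (digits n)))
  ... | q , odd-q , eq | r , odd-r , eq′ = r * q , odd-* odd-r odd-q , (begin
    2 ^ σ (suc n) * (suc n * n !)  ≡⟨ *-assoc (2 ^ σ (suc n)) (suc n) (n !) ⟨
    2 ^ σ (suc n) * suc n * n !    ≡⟨ cong (_* n !) eq′ ⟩
    2 ^ suc (σ n) * r * n !        ≡⟨ left (2 ^ σ n) r (n !) ⟩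
    2 * r * (2 ^ σ n * n !)        ≡⟨ cong (2 * r *_) eq ⟩
    2 * r * (2 ^ n * q)            ≡⟨ right r (2 ^ n) q ⟩
    2 ^ suc n * (r * q)            ∎)
    where
    left : ∀ x r y → 2 * x * r * y ≡ 2 * r * (x * y)
    left = solve-∀
    right : ∀ r x q → 2 * r * (x * q) ≡ 2 * x * (r * q)
    right = solve-∀

  -- The binomial coefficient (i + j choose i).
  choice : ℕ → ℕ → ℕ
  choice zero    j       = 1
  choice (suc i) zero    = 1
  choice (suc i) (suc j) = choice i (suc j) + choice (suc i) j

  choice-zeroʳ : ∀ i → choice i 0 ≡ 1
  choice-zeroʳ zero    = refl
  choice-zeroʳ (suc i) = refl

  choice-factorial : ∀ i j → choice i j * (i ! * j !) ≡ (i + j) !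
  choice-factorial zero    j       = trans (*-identityˡ _) (*-identityˡ _)
  choice-factorial (suc i) zero    = begin
    1 * (suc i ! * 1)  ≡⟨ trans (*-identityˡ _) (*-identityʳ _) ⟩
    suc i !            ≡⟨ cong _! (+-identityʳ (suc i)) ⟨
    (suc i + 0) !      ∎
  choice-factorial (suc i) (suc j) = begin
    (choice i (suc j) + choice (suc i) j) * (suc i * i ! * (suc j * j !))
      ≡⟨ split (choice i (suc j)) (choice (suc i) j) (suc i) (i !) (suc j) (j !) ⟩
    suc i * (choice i (suc j) * (i ! * suc j !)) + suc j * (choice (suc i) j * (suc i ! * j !))
      ≡⟨ cong₂ (λ x y → suc i * x + suc j * y) (choice-factorial i (suc j)) (choice-factorial (suc i) j) ⟩
    suc i * (i + suc j) ! + suc j * (suc i + j) !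
      ≡⟨ cong (λ k → suc i * (i + suc j) ! + suc j * k !) (+-suc i j) ⟨
    suc i * (i + suc j) ! + suc j * (i + suc j) !
      ≡⟨ *-distribʳ-+ ((i + suc j) !) (suc i) (suc j) ⟨
    (suc i + suc j) * (i + suc j) ! ∎
    where
    split : ∀ c d i x j y → (c + d) * (i * x * (j * y)) ≡ i * (c * (x * (j * y))) + j * (d * (i * x * y))
    split = solve-∀

  -- Legendre's formula for the three factorials of `choice-factorial`. The odd cofactors p and q
  -- encode that the valuation of `choice i j` is σ i + σ j - σ (i + j).
  kummer : ∀ i j → ∃₂ λ p q → Odd p × Odd q ×
           2 ^ (σ i + σ j) * p ≡ 2 ^ σ (i + j) * (choice i j * q)
  kummer i j with legendre i | legendre j | legendre (i + j)
  ... | qi , odd-i , eqi | qj , odd-j , eqj | qk , odd-k , eqk =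
    qk , qi * qj , odd-k , odd-* odd-i odd-j ,
    *-cancelˡ-≡ _ _ (2 ^ (i + j)) {{m^n≢0 2 (i + j)}} (begin
      2 ^ (i + j) * (2 ^ (σ i + σ j) * qk)
        ≡⟨ first (2 ^ (i + j)) (2 ^ (σ i + σ j)) qk ⟩
      2 ^ (i + j) * qk * 2 ^ (σ i + σ j)
        ≡⟨ cong₂ _*_ (sym eqk) (^-distribˡ-+-* 2 (σ i) (σ j)) ⟩
      2 ^ σ (i + j) * (i + j) ! * (2 ^ σ i * 2 ^ σ j)
        ≡⟨ cong (λ f → 2 ^ σ (i + j) * f * (2 ^ σ i * 2 ^ σ j)) (choice-factorial i j) ⟨
      2 ^ σ (i + j) * (choice i j * (i ! * j !)) * (2 ^ σ i * 2 ^ σ j)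
        ≡⟨ second (2 ^ σ (i + j)) (choice i j) (i !) (j !) (2 ^ σ i) (2 ^ σ j) ⟩
      2 ^ σ (i + j) * choice i j * ((2 ^ σ i * i !) * (2 ^ σ j * j !))
        ≡⟨ cong₂ (λ x y → 2 ^ σ (i + j) * choice i j * (x * y)) eqi eqj ⟩
      2 ^ σ (i + j) * choice i j * ((2 ^ i * qi) * (2 ^ j * qj))
        ≡⟨ third (2 ^ σ (i + j)) (choice i j) (2 ^ i) qi (2 ^ j) qj ⟩
      (2 ^ i * 2 ^ j) * (2 ^ σ (i + j) * (choice i j * (qi * qj)))
        ≡⟨ cong (_* (2 ^ σ (i + j) * (choice i j * (qi * qj)))) (^-distribˡ-+-* 2 i j) ⟨
      2 ^ (i + j) * (2 ^ σ (i + j) * (choice i j * (qi * qj))) ∎)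
    where
    first : ∀ x y q → x * (y * q) ≡ x * q * y
    first = solve-∀
    second : ∀ s c x y a b → s * (c * (x * y)) * (a * b) ≡ s * c * ((a * x) * (b * y))
    second = solve-∀
    third : ∀ s c a x b y → s * c * ((a * x) * (b * y)) ≡ (a * b) * (s * (c * (x * y)))
    third = solve-∀

  2^-mono-∣ : ∀ {m n} → m ≤ n → 2 ^ m ∣ 2 ^ n
  2^-mono-∣ {m} {n} m≤n = subst (λ k → 2 ^ m ∣ 2 ^ k) (m+[n∸m]≡n m≤n)
    (subst (2 ^ m ∣_) (sym (^-distribˡ-+-* 2 m (n ∸ m))) (m∣m*n _))

  2^-cancel-∣ : ∀ m n → 2 ^ m ∣ 2 ^ n → m ≤ n
  2^-cancel-∣ zero    n       _ = z≤n
  2^-cancel-∣ (suc m) zero    d with () ← m*n≡1⇒m≡1 2 (2 ^ m) (∣1⇒≡1 d)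
  2^-cancel-∣ (suc m) (suc n) d = s≤s (2^-cancel-∣ m n (*-cancelˡ-∣ 2 d))

  -- The difference of the two sides is the valuation of a binomial coefficient, which is an
  -- integer.
  σ-subadditive : ∀ i j → σ (i + j) ≤ σ i + σ j
  σ-subadditive i j with kummer i j
  ... | p , q , odd-p , _ , eq = 2^-cancel-∣ _ _
    (odd-cancel-∣ (σ (i + j)) (2 ^ (σ i + σ j)) odd-p (subst (2 ^ σ (i + j) ∣_) (sym eq) (m∣m*n _)))

  -- Adding r to 2 ^ n causes no carry, so the powers of 2 in `kummer` cancel and the coefficient
  -- divides an odd number.
  choice-odd : ∀ n r → r < 2 ^ n → Odd (choice (2 ^ n) r)
  choice-odd n r r<2^n with kummer (2 ^ n) r
  ... | p , q , odd-p , odd-q , eq = odd-factor (choice (2 ^ n) r) (subst Odd p≡ odd-p)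
    where
    p≡ : p ≡ choice (2 ^ n) r * q
    p≡ = *-cancelˡ-≡ _ _ (2 ^ suc (σ r)) {{m^n≢0 2 (suc (σ r))}}
      (trans (cong (λ e → 2 ^ (e + σ r) * p) (sym (σ-pow n)))
        (trans eq (cong (λ e → 2 ^ e * (choice (2 ^ n) r * q)) (σ-pow+ n r r<2^n))))

  -- Digits from position L upwards, and carries into them.

  highSum : ℕ → ℕ → ℕ
  highSum L k = σ (_/_ k (2 ^ L) {{m^n≢0 2 L}})

  highSum-split : ∀ L b a → a < 2 ^ L → highSum L (b * 2 ^ L + a) ≡ σ b
  highSum-split L b a a<2^L = cong σ (begin
    (b * 2 ^ L + a) / 2 ^ L  ≡⟨ +-distrib-/-∣ˡ a (n∣m*n b) ⟩
    b * 2 ^ L / 2 ^ L + a / 2 ^ L ≡⟨ cong₂ _+_ (m*n/n≡m b (2 ^ L)) (m<n⇒m/n≡0 a<2^L) ⟩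
    b + 0  ≡⟨ +-identityʳ b ⟩
    b ∎)
    where instance _ = m^n≢0 2 L

  split-by-2^ : ∀ L k → ∃₂ λ b a → a < 2 ^ L × k ≡ b * 2 ^ L + a
  split-by-2^ L k = k / 2 ^ L , k % 2 ^ L , m%n<n k (2 ^ L) ,
    trans (m≡m%n+[m/n]*n k (2 ^ L)) (+-comm (k % 2 ^ L) _)
    where instance _ = m^n≢0 2 L

  -- The digit sums of the high parts of i, j and i + j occur on both sides and cancel. What remains
  -- is subadditivity for the low parts a and c, with 2 ^ L taken off their sum if it overflows.
  highSum-carry : ∀ L i j → highSum L i + highSum L j + σ (i + j) ≤ σ i + σ j + highSum L (i + j)
  highSum-carry L i j with split-by-2^ L i | split-by-2^ L j
  ... | b , a , a< , refl | d , c , c< , refl = go (a + c <? 2 ^ L)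
    where
    N = 2 ^ L
    sum≡ : ∀ b d N a c → b * N + a + (d * N + c) ≡ (b + d) * N + (a + c)
    sum≡ = solve-∀
    reduce : ∀ e r → r < N → b * N + a + (d * N + c) ≡ e * N + r → σ r ≤ σ a + σ c →
      highSum L (b * N + a) + highSum L (d * N + c) + σ (b * N + a + (d * N + c))
      ≤ σ (b * N + a) + σ (d * N + c) + highSum L (b * N + a + (d * N + c))
    reduce e r r< eq le rewrite eq | highSum-split L b a a< | highSum-split L d c c<
      | highSum-split L e r r< | σ-split L b a a< | σ-split L d c c< | σ-split L e r r< =
      subst₂ _≤_ (left (σ b) (σ d) (σ e) (σ r)) (right (σ b) (σ d) (σ e) (σ a) (σ c))
        (+-monoʳ-≤ (σ b + σ d + σ e) le)
      where
      left : ∀ b d e r → b + d + e + r ≡ b + d + (e + r)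
      left = solve-∀
      right : ∀ b d e a c → b + d + e + (a + c) ≡ b + a + (d + c) + e
      right = solve-∀
    go : Dec (a + c < N) → _
    go (yes a+c<N) = reduce (b + d) (a + c) a+c<N (sum≡ b d N a c) (σ-subadditive a c)
    go (no  a+c≮N) = reduce (suc (b + d)) r r<N eq s-r
      where
      r = a + c ∸ N
      N+r : N + r ≡ a + c
      N+r = m+[n∸m]≡n (≮⇒≥ a+c≮N)
      r<N : r < N
      r<N = +-cancelˡ-< N r N (subst (_< N + N) (sym N+r) (+-mono-< a< c<))
      carry : ∀ e N r → e * N + (N + r) ≡ (suc e) * N + r
      carry = solve-∀
      eq : b * N + a + (d * N + c) ≡ suc (b + d) * N + r
      eq = trans (sum≡ b d N a c) (trans (cong ((b + d) * N +_) (sym N+r)) (carry (b + d) N r))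
      -- The overflow 2 ^ L accounts for one digit 1 of a + c, so dropping it only lowers the digit
      -- sum.
      s-r : σ r ≤ σ a + σ c
      s-r = ≤-trans (n≤1+n _) (subst (_≤ σ a + σ c)
        (trans (cong σ (sym N+r)) (σ-pow+ L r r<N)) (σ-subadditive a c))

  -- The valuation of `choice i j` is σ i + σ j - σ (i + j), so this is `highSum-carry` in the
  -- exponent. It is the fact that makes `B` multiplicative.
  highSum-choice : ∀ L i j → 2 ^ (highSum L i + highSum L j) ∣ 2 ^ highSum L (i + j) * choice i j
  highSum-choice L i j with kummer i j
  ... | p , q , _ , odd-q , eq = odd-cancel-∣ (hi + hj) (2 ^ hk * choice i j) odd-q
    (*-cancelˡ-∣ (2 ^ sk) {{m^n≢0 2 sk}}
      (subst₂ _∣_ lhs rhs (∣m⇒∣m*n p (2^-mono-∣ (highSum-carry L i j)))))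
    where
    hi = highSum L i
    hj = highSum L j
    hk = highSum L (i + j)
    sk = σ (i + j)
    lhs : 2 ^ (hi + hj + sk) ≡ 2 ^ sk * 2 ^ (hi + hj)
    lhs = trans (^-distribˡ-+-* 2 (hi + hj) sk) (*-comm (2 ^ (hi + hj)) _)
    rhs : 2 ^ (σ i + σ j + hk) * p ≡ 2 ^ sk * (2 ^ hk * choice i j * q)
    rhs = begin
      2 ^ (σ i + σ j + hk) * p              ≡⟨ cong (_* p) (^-distribˡ-+-* 2 (σ i + σ j) hk) ⟩
      2 ^ (σ i + σ j) * 2 ^ hk * p          ≡⟨ sw (2 ^ (σ i + σ j)) (2 ^ hk) p ⟩
      2 ^ hk * (2 ^ (σ i + σ j) * p)        ≡⟨ cong (2 ^ hk *_) eq ⟩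
      2 ^ hk * (2 ^ sk * (choice i j * q))  ≡⟨ sw′ (2 ^ hk) (2 ^ sk) (choice i j) q ⟩
      2 ^ sk * (2 ^ hk * choice i j * q)    ∎
      where
      sw : ∀ x y z → x * y * z ≡ y * (x * z)
      sw = solve-∀
      sw′ : ∀ x y z w → x * (y * (z * w)) ≡ y * (x * z * w)
      sw′ = solve-∀

  highSum-positive : ∀ L k → 2 ^ L ≤ k → 1 ≤ highSum L k
  highSum-positive L k 2^L≤k with split-by-2^ L k
  ... | zero  , a , a< , refl = contradiction a< (≤⇒≯ 2^L≤k)
  ... | suc b , a , a< , refl = subst (1 ≤_) (sym (highSum-split L (suc b) a a<)) (σ-positive (suc b) (s≤s z≤n))

-- Finite differences, the Leibniz rule and the class `B`.

module FiniteDifferences where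
  open BinaryDigits
  open import Data.Integer.Base using (ℤ; +_; _+_; _*_; _-_; -_; 0ℤ; 1ℤ)
  open import Data.Integer.Divisibility.Signed
  open import Data.Integer.Properties
  open import Data.Integer.Tactic.RingSolver using (solve-∀)
  open import Data.Nat.Base as ℕ using (ℕ; zero; suc; _<_; _≤_; z≤n; s≤s; s≤s⁻¹)
  import Data.Nat.Divisibility as ℕ
  import Data.Nat.Properties as ℕ
  open import Data.Product.Base using (_×_; _,_)
  open import Data.Sum.Base using (inj₁; inj₂)
  open import Function.Base using (_∘_)
  open import Relation.Binary.Definitions using (tri<; tri≈; tri>)
  open import Relation.Binary.PropositionalEquality
  open import Relation.Nullary using (contradiction)

  pow : ℕ → ℤ
  pow k = + (2 ℕ.^ k)

  pow-suc : ∀ k → pow (suc k) ≡ + 2 * pow k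
  pow-suc k = pos-* 2 (2 ℕ.^ k)

  pow-+ : ∀ i j → pow (i ℕ.+ j) ≡ pow i * pow j
  pow-+ i j = trans (cong +_ (ℕ.^-distribˡ-+-* 2 i j)) (pos-* (2 ℕ.^ i) (2 ℕ.^ j))

  infixl 7 _·_
  infixl 6 _⊕_

  _·_ _⊕_ : (ℕ → ℤ) → (ℕ → ℤ) → ℕ → ℤ
  (f · g) x = f x * g x
  (f ⊕ g) x = f x + g x

  twice : (ℕ → ℤ) → ℕ → ℤ
  twice f x = + 2 * f x

  Δ : (ℕ → ℤ) → ℕ → ℤ
  Δ f x = f (suc x) - f x

  Δ^ : ℕ → (ℕ → ℤ) → ℕ → ℤ
  Δ^ zero    f = f
  Δ^ (suc k) f = Δ^ k (Δ f)

  Δ^-cong : ∀ k {f g} → f ≗ g → Δ^ k f ≗ Δ^ k g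
  Δ^-cong zero    f≗g = f≗g
  Δ^-cong (suc k) f≗g = Δ^-cong k λ x → cong₂ _-_ (f≗g (suc x)) (f≗g x)

  Δ^-⊕ : ∀ k f g x → Δ^ k (f ⊕ g) x ≡ Δ^ k f x + Δ^ k g x
  Δ^-⊕ zero    f g x = refl
  Δ^-⊕ (suc k) f g x = trans
    (Δ^-cong k (λ y → lemma (f (suc y)) (f y) (g (suc y)) (g y)) x) (Δ^-⊕ k (Δ f) (Δ g) x)
    where
    lemma : ∀ a b c d → a + c - (b + d) ≡ (a - b) + (c - d)
    lemma = solve-∀

  Δ^-scale : ∀ k c f x → Δ^ k (λ y → c * f y) x ≡ c * Δ^ k f x
  Δ^-scale zero    c f x = refl
  Δ^-scale (suc k) c f x = trans
    (Δ^-cong k (λ y → lemma c (f (suc y)) (f y)) x) (Δ^-scale k c (Δ f) x)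
    where
    lemma : ∀ c a b → c * a - c * b ≡ c * (a - b)
    lemma = solve-∀

  Δ^-shift : ∀ k f x → Δ^ k (f ∘ suc) x ≡ Δ^ k f (suc x)
  Δ^-shift zero    f x = refl
  Δ^-shift (suc k) f x = Δ^-shift k (Δ f) x

  -- The sum of (k choose i) * F i j over i + j = k: Pascal's rule is the recursion.
  bsum : ℕ → (ℕ → ℕ → ℤ) → ℤ
  bsum zero    F = F 0 0
  bsum (suc k) F = bsum k (λ i j → F (suc i) j) + bsum k (λ i j → F i (suc j))

  bsum-cong : ∀ k {F G} → (∀ i j → i ℕ.+ j ≡ k → F i j ≡ G i j) → bsum k F ≡ bsum k G
  bsum-cong zero    F≡G = F≡G 0 0 refl
  bsum-cong (suc k) F≡G = cong₂ _+_
    (bsum-cong k λ i j eq → F≡G (suc i) j (cong suc eq))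
    (bsum-cong k λ i j eq → F≡G i (suc j) (trans (ℕ.+-suc i j) (cong suc eq)))

  bsum-scale : ∀ k c F → bsum k (λ i j → c * F i j) ≡ c * bsum k F
  bsum-scale zero    c F = refl
  bsum-scale (suc k) c F = trans
    (cong₂ _+_ (bsum-scale k c _) (bsum-scale k c _)) (sym (*-distribˡ-+ c _ _))

  -- The product rule is used as Δ f · g + (f ∘ suc) · Δ g: every difference spent on g shifts f by
  -- one, whence the argument j + x.
  leibniz : ∀ k f g x → Δ^ k (f · g) x ≡ bsum k (λ i j → Δ^ i f (j ℕ.+ x) * Δ^ j g x)
  leibniz zero    f g x = refl
  leibniz (suc k) f g x = begin
    Δ^ k (Δ (f · g)) x
      ≡⟨ Δ^-cong k (λ y → product-rule (f (suc y)) (f y) (g (suc y)) (g y)) x ⟩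
    Δ^ k (Δ f · g ⊕ (f ∘ suc) · Δ g) x
      ≡⟨ Δ^-⊕ k (Δ f · g) ((f ∘ suc) · Δ g) x ⟩
    Δ^ k (Δ f · g) x + Δ^ k ((f ∘ suc) · Δ g) x
      ≡⟨ cong₂ _+_ (leibniz k (Δ f) g x) (leibniz k (f ∘ suc) (Δ g) x) ⟩
    bsum k (λ i j → Δ^ (suc i) f (j ℕ.+ x) * Δ^ j g x)
      + bsum k (λ i j → Δ^ i (f ∘ suc) (j ℕ.+ x) * Δ^ (suc j) g x)
      ≡⟨ cong (λ s → bsum k (λ i j → Δ^ (suc i) f (j ℕ.+ x) * Δ^ j g x) + s)
           (bsum-cong k λ i j _ → cong (_* Δ^ (suc j) g x) (Δ^-shift i f (j ℕ.+ x))) ⟩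
    bsum (suc k) (λ i j → Δ^ i f (j ℕ.+ x) * Δ^ j g x) ∎
    where
    open ≡-Reasoning
    product-rule : ∀ a b c d → a * c - b * d ≡ (a - b) * d + a * (c - d)
    product-rule = solve-∀

  antidiagonal : ℕ → (ℕ → ℕ → ℤ) → ℤ
  antidiagonal zero    F = F 0 0
  antidiagonal (suc k) F = F 0 (suc k) + antidiagonal k (F ∘ suc)

  antidiagonal-cong : ∀ k {F G} → (∀ i j → F i j ≡ G i j) → antidiagonal k F ≡ antidiagonal k G
  antidiagonal-cong zero    F≡G = F≡G 0 0
  antidiagonal-cong (suc k) F≡G = cong₂ _+_ (F≡G 0 (suc k)) (antidiagonal-cong k (F≡G ∘ suc))

  antidiagonal-+ : ∀ k F G → antidiagonal k (λ i j → F i j + G i j) ≡ antidiagonal k F + antidiagonal k G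
  antidiagonal-+ zero    F G = refl
  antidiagonal-+ (suc k) F G = trans
    (cong (_+_ (F 0 (suc k) + G 0 (suc k))) (antidiagonal-+ k (F ∘ suc) (G ∘ suc)))
    (lemma (F 0 (suc k)) (G 0 (suc k)) _ _)
    where
    lemma : ∀ a b c d → a + b + (c + d) ≡ a + c + (b + d)
    lemma = solve-∀

  antidiagonal-last : ∀ k F → antidiagonal (suc k) F ≡ antidiagonal k (λ i j → F i (suc j)) + F (suc k) 0
  antidiagonal-last zero    F = refl
  antidiagonal-last (suc k) F = trans
    (cong (_+_ (F 0 (suc (suc k)))) (antidiagonal-last k (F ∘ suc)))
    (sym (+-assoc (F 0 (suc (suc k))) _ _))

  -- choiceBelow i j is (i + j - 1 choose i), read as 0 when j = 0.
  choiceBelow : ℕ → ℕ → ℕ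
  choiceBelow i zero    = 0
  choiceBelow i (suc j) = choice i j

  choice-pascal : ∀ i j → choice (suc i) j ≡ choice i j ℕ.+ choiceBelow (suc i) j
  choice-pascal i zero    = sym (trans (ℕ.+-identityʳ _) (choice-zeroʳ i))
  choice-pascal i (suc j) = refl

  -- The second half of the recursion is extended by a term at j = 0, where `choiceBelow` is 0, and
  -- then split at i = 0. After this both halves run over the same pairs and Pascal's rule applies
  -- termwise.
  bsum≡antidiagonal : ∀ k F → bsum k F ≡ antidiagonal k (λ i j → + choice i j * F i j)
  bsum≡antidiagonal zero    F = sym (*-identityˡ _)
  bsum≡antidiagonal (suc k) F = begin
    bsum k (λ i j → F (suc i) j) + bsum k (λ i j → F i (suc j))
      ≡⟨ cong₂ _+_ (bsum≡antidiagonal k _) (bsum≡antidiagonal k _) ⟩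
    A + antidiagonal k (λ i j → + choice i j * F i (suc j))
      ≡⟨ cong (_+_ A) (sym (trans (antidiagonal-last k G) (+-identityʳ _))) ⟩
    A + (1ℤ * F 0 (suc k) + antidiagonal k (G ∘ suc))
      ≡⟨ lemma A (1ℤ * F 0 (suc k)) (antidiagonal k (G ∘ suc)) ⟩
    1ℤ * F 0 (suc k) + (A + antidiagonal k (G ∘ suc))
      ≡⟨ cong (_+_ (1ℤ * F 0 (suc k))) (trans (sym (antidiagonal-+ k _ _)) (antidiagonal-cong k pascal)) ⟩
    antidiagonal (suc k) (λ i j → + choice i j * F i j) ∎
    where
    open ≡-Reasoning
    A = antidiagonal k (λ i j → + choice i j * F (suc i) j)
    G : ℕ → ℕ → ℤ
    G i j = + choiceBelow i j * F i j
    lemma : ∀ a b c → a + (b + c) ≡ b + (a + c)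
    lemma = solve-∀
    pascal : ∀ i j → + choice i j * F (suc i) j + G (suc i) j ≡ + choice (suc i) j * F (suc i) j
    pascal i j = trans (sym (*-distribʳ-+ (F (suc i) j) (+ choice i j) (+ choiceBelow (suc i) j)))
      (cong (λ c → + c * F (suc i) j) (sym (choice-pascal i j)))

  antidiagonal-∣ : ∀ m k F → (∀ i j → i ℕ.+ j ≡ k → m ∣ F i j) → m ∣ antidiagonal k F
  antidiagonal-∣ m zero    F m∣F = m∣F 0 0 refl
  antidiagonal-∣ m (suc k) F m∣F = ∣m∣n⇒∣m+n (m∣F 0 (suc k) refl)
    (antidiagonal-∣ m k (F ∘ suc) λ i j eq → m∣F (suc i) j (cong suc eq))

  -- 2 ^ highSum L k is the denominator allowed in Δ^ k f divided by 2 ^ k.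
  B : ℕ → (ℕ → ℤ) → Set
  B L f = ∀ k x → pow k ∣ pow (highSum L k) * Δ^ k f x

  B-cong : ∀ L {f g} → f ≗ g → B L f → B L g
  B-cong L f≗g b k x = subst (λ y → pow k ∣ pow (highSum L k) * y) (Δ^-cong k f≗g x) (b k x)

  B-⊕ : ∀ L f g → B L f → B L g → B L (f ⊕ g)
  B-⊕ L f g bf bg k x = subst (pow k ∣_)
    (sym (trans (cong (pow (highSum L k) *_) (Δ^-⊕ k f g x)) (*-distribˡ-+ (pow (highSum L k)) _ _)))
    (∣m∣n⇒∣m+n (bf k x) (bg k x))

  *-mono-∣ : ∀ {a b c d} → a ∣ b → c ∣ d → a * c ∣ b * d
  *-mono-∣ {a} {b} {c} {d} a∣b c∣d = ∣-trans (*-monoˡ-∣ c a∣b) (*-monoʳ-∣ b c∣d)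

  -- In each Leibniz term the binomial coefficient pays for the two separate weights, by
  -- `highSum-choice`. The shift j + x in that term is why `B` speaks of every argument x.
  B-· : ∀ L f g → B L f → B L g → B L (f · g)
  B-· L f g bf bg k x = subst (pow k ∣_) (sym expand) (antidiagonal-∣ (pow k) k _ term)
    where
    H = pow (highSum L k)
    F : ℕ → ℕ → ℤ
    F i j = Δ^ i f (j ℕ.+ x) * Δ^ j g x
    expand : H * Δ^ k (f · g) x ≡ antidiagonal k (λ i j → + choice i j * (H * F i j))
    expand = trans (cong (H *_) (leibniz k f g x))
      (trans (sym (bsum-scale k H F)) (bsum≡antidiagonal k _))
    regroup : ∀ a b u v → (a * u) * (b * v) ≡ (a * b) * (u * v)
    regroup = solve-∀
    assoc : ∀ h c w → h * c * w ≡ c * (h * w)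
    assoc = solve-∀
    term : ∀ i j → i ℕ.+ j ≡ k → pow k ∣ + choice i j * (H * F i j)
    term i j refl = subst (pow (i ℕ.+ j) ∣_) (assoc H (+ choice i j) (F i j))
      (∣-trans
        (subst₂ _∣_ (sym (pow-+ i j))
          (trans (regroup (pow hi) (pow hj) _ _) (cong (_* F i j) (sym (pow-+ hi hj))))
          (*-mono-∣ (bf i (j ℕ.+ x)) (bg j x)))
        (*-monoˡ-∣ (F i j) (subst (pow (hi ℕ.+ hj) ∣_) (pos-* (2 ℕ.^ highSum L (i ℕ.+ j)) (choice i j))
          (∣ᵤ⇒∣ (highSum-choice L i j)))))
      where
      hi = highSum L i
      hj = highSum L j

  -- Parities of the quotients of k-th differences by 2 ^ k.

  infix 4 _≈₂_
  -- A record instead of bare divisibility, so that a and b can be inferred from the type.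
  record _≈₂_ (a b : ℤ) : Set where
    constructor congruent
    field 2∣a-b : + 2 ∣ a - b
  open _≈₂_

  ≈₂-refl : ∀ {a} → a ≈₂ a
  ≈₂-refl {a} = congruent (divides 0ℤ (+-inverseʳ a))

  ≈₂-reflexive : ∀ {a b} → a ≡ b → a ≈₂ b
  ≈₂-reflexive refl = ≈₂-refl

  ≈₂-trans : ∀ {a b c} → a ≈₂ b → b ≈₂ c → a ≈₂ c
  ≈₂-trans {a} {b} {c} (congruent p) (congruent q) =
    congruent (subst (+ 2 ∣_) (lemma a b c) (∣m∣n⇒∣m+n p q))
    where
    lemma : ∀ a b c → a - b + (b - c) ≡ a - c
    lemma = solve-∀

  +-cong-≈₂ : ∀ {a b c d} → a ≈₂ b → c ≈₂ d → a + c ≈₂ b + d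
  +-cong-≈₂ {a} {b} {c} {d} (congruent p) (congruent q) =
    congruent (subst (+ 2 ∣_) (lemma a b c d) (∣m∣n⇒∣m+n p q))
    where
    lemma : ∀ a b c d → a - b + (c - d) ≡ a + c - (b + d)
    lemma = solve-∀

  *-cong-≈₂ : ∀ {a b c d} → a ≈₂ b → c ≈₂ d → a * c ≈₂ b * d
  *-cong-≈₂ {a} {b} {c} {d} (congruent p) (congruent q) =
    congruent (subst (+ 2 ∣_) (lemma a b c d) (∣m∣n⇒∣m+n (∣n⇒∣m*n c p) (∣n⇒∣m*n b q)))
    where
    lemma : ∀ a b c d → c * (a - b) + b * (c - d) ≡ a * c - b * d
    lemma = solve-∀

  2*≈₂0 : ∀ a → + 2 * a ≈₂ 0ℤ
  2*≈₂0 a = congruent (divides a (lemma a))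
    where
    lemma : ∀ a → + 2 * a - 0ℤ ≡ a * + 2
    lemma = solve-∀

  2≈₂0 : + 2 ≈₂ 0ℤ
  2≈₂0 = 2*≈₂0 1ℤ

  ≈₂0⇒2∣ : ∀ {a} → a ≈₂ 0ℤ → + 2 ∣ a
  ≈₂0⇒2∣ {a} (congruent p) = subst (+ 2 ∣_) (+-identityʳ a) p

  -‿≈₂ : ∀ a → - a ≈₂ a
  -‿≈₂ a = congruent (divides (- a) (lemma a))
    where
    lemma : ∀ a → - a - a ≡ - a * + 2
    lemma = solve-∀

  antidiagonal-even : ∀ k F → (∀ i j → i ℕ.+ j ≡ k → F i j ≈₂ 0ℤ) → antidiagonal k F ≈₂ 0ℤ
  antidiagonal-even zero    F F≈0 = F≈0 0 0 refl
  antidiagonal-even (suc k) F F≈0 = +-cong-≈₂ (F≈0 0 (suc k) refl)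
    (antidiagonal-even k (F ∘ suc) λ i j eq → F≈0 (suc i) j (cong suc eq))

  antidiagonal-single : ∀ m r F → (∀ i j → i ≢ m → F i j ≈₂ 0ℤ) → antidiagonal (m ℕ.+ r) F ≈₂ F m r
  antidiagonal-single zero    zero    F F≈0 = ≈₂-refl
  antidiagonal-single zero    (suc r) F F≈0 = ≈₂-trans
    (+-cong-≈₂ (≈₂-refl {F 0 (suc r)}) (antidiagonal-even r (F ∘ suc) λ i j _ → F≈0 (suc i) j λ ()))
    (≈₂-reflexive (+-identityʳ _))
  antidiagonal-single (suc m) r       F F≈0 = ≈₂-trans
    (+-cong-≈₂ (F≈0 0 (suc (m ℕ.+ r)) λ ())
      (antidiagonal-single m r (F ∘ suc) λ i j i≢m → F≈0 (suc i) j (i≢m ∘ ℕ.suc-injective)))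
    (≈₂-reflexive (+-identityˡ _))

  -- Here a k x is the k-th Newton coefficient of f based at x, divided by 2 ^ k. Keeping this
  -- quotient gives access to the next power of 2.
  Expansion : (ℕ → ℤ) → (ℕ → ℕ → ℤ) → Set
  Expansion f a = ∀ k x → Δ^ k f x ≡ pow k * a k x

  expansion-cong : ∀ {f g a} → f ≗ g → Expansion f a → Expansion g a
  expansion-cong f≗g ef k x = trans (sym (Δ^-cong k f≗g x)) (ef k x)

  expansion-⊕ : ∀ {f g a b} → Expansion f a → Expansion g b → Expansion (f ⊕ g) (λ k x → a k x + b k x)
  expansion-⊕ {f} {g} ef eg k x = trans (Δ^-⊕ k f g x)
    (trans (cong₂ _+_ (ef k x) (eg k x)) (sym (*-distribˡ-+ (pow k) _ _)))

  expansion-scale : ∀ c {f a} → Expansion f a → Expansion (λ x → c * f x) (λ k x → c * a k x)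
  expansion-scale c {f} {a} ef k x = trans (Δ^-scale k c f x)
    (trans (cong (c *_) (ef k x)) (lemma c (pow k) (a k x)))
    where
    lemma : ∀ c p a → c * (p * a) ≡ p * (c * a)
    lemma = solve-∀

  _⊛_ : (ℕ → ℕ → ℤ) → (ℕ → ℕ → ℤ) → ℕ → ℕ → ℤ
  (a ⊛ b) k x = bsum k (λ i j → a i (j ℕ.+ x) * b j x)

  -- In each Leibniz term the powers of 2 multiply to `pow k`, so the quotients undergo the same
  -- binomial convolution as the differences.
  expansion-· : ∀ {f g a b} → Expansion f a → Expansion g b → Expansion (f · g) (a ⊛ b)
  expansion-· {f} {g} {a} {b} ef eg k x = trans (leibniz k f g x)
    (trans (bsum-cong k term) (bsum-scale k (pow k) _))
    where
    regroup : ∀ a b u v → (a * u) * (b * v) ≡ (a * b) * (u * v)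
    regroup = solve-∀
    term : ∀ i j → i ℕ.+ j ≡ k →
      Δ^ i f (j ℕ.+ x) * Δ^ j g x ≡ pow k * (a i (j ℕ.+ x) * b j x)
    term i j refl = trans (cong₂ _*_ (ef i (j ℕ.+ x)) (eg j x))
      (trans (regroup (pow i) (pow j) _ _) (cong (_* (a i (j ℕ.+ x) * b j x)) (sym (pow-+ i j))))

  -- The coefficients modulo 2 of 1 + 2 ^ (m + 1) * (x choose m + 1).
  record Peaked (m : ℕ) (τ : ℕ → ℕ → ℤ) : Set where
    field
      at-zero : ∀ x → τ 0 x ≈₂ 1ℤ
      at-peak : ∀ x → τ (suc m) x ≈₂ 1ℤ
      off     : ∀ k x → k ≢ m → τ (suc k) x ≈₂ 0ℤ

  module _ {m τ} (peaked : Peaked m τ) (b : ℕ → ℕ → ℤ) where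
    open Peaked peaked

    private
      term : ℕ → ℕ → ℕ → ℤ
      term x i j = + choice (suc i) j * (τ (suc i) (j ℕ.+ x) * b j x)

      off-term : ∀ x i j → i ≢ m → term x i j ≈₂ 0ℤ
      off-term x i j i≢m = ≈₂-trans
        (*-cong-≈₂ (≈₂-refl {+ choice (suc i) j}) (*-cong-≈₂ (off i (j ℕ.+ x) i≢m) (≈₂-refl {b j x})))
        (≈₂-reflexive (*-zeroʳ (+ choice (suc i) j)))

      product : ℕ → ℕ → ℕ → ℤ
      product x i j = τ i (j ℕ.+ x) * b j x

      first : ∀ k x → 1ℤ * (τ 0 (k ℕ.+ x) * b k x) ≈₂ b k x
      first k x = ≈₂-trans (≈₂-reflexive (*-identityˡ _))
        (≈₂-trans (*-cong-≈₂ (at-zero (k ℕ.+ x)) (≈₂-refl {b k x})) (≈₂-reflexive (*-identityˡ _)))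

    ⊛-below-peak : ∀ k x → k < suc m → (τ ⊛ b) k x ≈₂ b k x
    ⊛-below-peak zero    x _ = ≈₂-trans (≈₂-reflexive (sym (*-identityˡ _))) (first 0 x)
    ⊛-below-peak (suc k) x k<m = ≈₂-trans (≈₂-reflexive (bsum≡antidiagonal (suc k) (product x)))
      (≈₂-trans (+-cong-≈₂ (first (suc k) x)
          (antidiagonal-even k (term x) λ i j i+j≡k → off-term x i j
            (ℕ.<⇒≢ (ℕ.≤-<-trans (ℕ.m+n≤o⇒m≤o i (ℕ.≤-reflexive i+j≡k)) (s≤s⁻¹ k<m)))))
        (≈₂-reflexive (+-identityʳ _)))

    -- Modulo 2 only two terms of the convolution survive: i = 0, and the peak i = suc m with its
    -- binomial coefficient.
    ⊛-above-peak : ∀ r x → (τ ⊛ b) (suc m ℕ.+ r) x ≈₂ b (suc m ℕ.+ r) x + + choice (suc m) r * b r x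
    ⊛-above-peak r x = ≈₂-trans (≈₂-reflexive (bsum≡antidiagonal (suc m ℕ.+ r) (product x)))
      (+-cong-≈₂ (first (suc m ℕ.+ r) x)
        (≈₂-trans (antidiagonal-single m r (term x) (off-term x))
          (*-cong-≈₂ (≈₂-refl {+ choice (suc m) r})
            (≈₂-trans (*-cong-≈₂ (at-peak (r ℕ.+ x)) (≈₂-refl {b r x})) (≈₂-reflexive (*-identityˡ _))))))

  -- The pattern of `power N` for N a power of 2. The exact coefficients grow complicated, but this
  -- pattern of parities reproduces itself under squaring, with N doubled.
  record Steps (N : ℕ) (z : ℕ → ℤ) : Set where
    field
      coeff     : ℕ → ℕ → ℤ
      expansion : Expansion (Δ z) coeff
      below     : ∀ k x → k < N → coeff k x ≈₂ 1ℤ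
      above     : ∀ k x → N ≤ k → coeff k x ≈₂ 0ℤ

  ChoiceOdd : ℕ → Set
  ChoiceOdd N = ∀ r → r < N → + choice N r ≈₂ 1ℤ

  module _ {m z} (steps : Steps (suc m) z) where
    open Steps steps

    -- Δ (z · z) = t · Δ z.
    t : ℕ → ℤ
    t = twice z ⊕ Δ z

    -- In the difference of order suc k, the factor of `twice z` raises 2 ^ k to 2 ^ suc k, so two
    -- neighbouring coefficients of Δ z add up.
    τ : ℕ → ℕ → ℤ
    τ zero    x = t x
    τ (suc k) x = coeff k x + coeff (suc k) x

    t-expansion : Expansion t τ
    t-expansion zero    x = sym (*-identityˡ _)
    t-expansion (suc k) x = begin
      Δ^ (suc k) (twice z ⊕ Δ z) x
        ≡⟨ Δ^-⊕ (suc k) (twice z) (Δ z) x ⟩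
      Δ^ (suc k) (twice z) x + Δ^ (suc k) (Δ z) x
        ≡⟨ cong₂ _+_ (Δ^-scale (suc k) (+ 2) z x) (expansion (suc k) x) ⟩
      + 2 * Δ^ k (Δ z) x + pow (suc k) * coeff (suc k) x
        ≡⟨ cong (λ y → + 2 * y + pow (suc k) * coeff (suc k) x) (expansion k x) ⟩
      + 2 * (pow k * coeff k x) + pow (suc k) * coeff (suc k) x
        ≡⟨ cong (_+ pow (suc k) * coeff (suc k) x)
           (trans (sym (*-assoc (+ 2) (pow k) _)) (cong (_* coeff k x) (sym (pow-suc k)))) ⟩
      pow (suc k) * coeff k x + pow (suc k) * coeff (suc k) x
        ≡⟨ *-distribˡ-+ (pow (suc k)) _ _ ⟨
      pow (suc k) * τ (suc k) x ∎
      where open ≡-Reasoning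

    -- Sums of neighbours in a step pattern are even except across the drop from 1 to 0, which
    -- produces the peak.
    t-peaked : Peaked m τ
    t-peaked = record
      { at-zero = λ x → +-cong-≈₂ (2*≈₂0 (z x)) (Δz≈1 x)
      ; at-peak = λ x → +-cong-≈₂ (below m x ℕ.≤-refl) (above (suc m) x ℕ.≤-refl)
      ; off     = off
      }
      where
      Δz≈1 : ∀ x → Δ z x ≈₂ 1ℤ
      Δz≈1 x = ≈₂-trans (≈₂-reflexive (trans (expansion 0 x) (*-identityˡ _))) (below 0 x (s≤s z≤n))
      off : ∀ k x → k ≢ m → τ (suc k) x ≈₂ 0ℤ
      off k x k≢m with ℕ.<-cmp k m
      ... | tri< k<m _ _ = ≈₂-trans (+-cong-≈₂ (below k x (ℕ.m<n⇒m<1+n k<m)) (below (suc k) x (s≤s k<m))) 2≈₂0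
      ... | tri≈ _ k≡m _ = contradiction k≡m k≢m
      ... | tri> _ _ m<k = +-cong-≈₂ (above k x m<k) (above (suc k) x (ℕ.m≤n⇒m≤1+n m<k))

    -- Let N = suc m. Below N the product t · Δ z has the parities of Δ z. Between N and 2 N those
    -- have dropped to 0, but the peak adds an odd binomial coefficient times 1. From 2 N on both
    -- contributions are even.
    steps-square : ChoiceOdd (suc m) → Steps (suc m ℕ.+ suc m) (z · z)
    steps-square odd = record
      { coeff     = τ ⊛ coeff
      ; expansion = expansion-cong (λ x → difference-of-squares (z (suc x)) (z x))
                      (expansion-· t-expansion expansion)
      ; below     = below′
      ; above     = above′
      }
      where
      difference-of-squares : ∀ a b → (+ 2 * b + (a - b)) * (a - b) ≡ a * a - b * b
      difference-of-squares = solve-∀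
      below′ : ∀ k x → k < suc m ℕ.+ suc m → (τ ⊛ coeff) k x ≈₂ 1ℤ
      below′ k x k<2N with ℕ.<-≤-connex k (suc m)
      ... | inj₁ k<N = ≈₂-trans (⊛-below-peak t-peaked coeff k x k<N) (below k x k<N)
      ... | inj₂ N≤k with ℕ.m≤n⇒∃[o]m+o≡n N≤k
      ... | r , refl = ≈₂-trans (⊛-above-peak t-peaked coeff r x)
        (+-cong-≈₂ (above _ x N≤k) (*-cong-≈₂ (odd r r<N) (below r x r<N)))
        where r<N = ℕ.+-cancelˡ-< (suc m) r (suc m) k<2N
      above′ : ∀ k x → suc m ℕ.+ suc m ≤ k → (τ ⊛ coeff) k x ≈₂ 0ℤ
      above′ k x 2N≤k with ℕ.m≤n⇒∃[o]m+o≡n (ℕ.m+n≤o⇒m≤o (suc m) 2N≤k)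
      ... | r , refl = ≈₂-trans (⊛-above-peak t-peaked coeff r x)
        (≈₂-trans (+-cong-≈₂ (above _ x (ℕ.m≤m+n (suc m) r))
            (*-cong-≈₂ (≈₂-refl {+ choice (suc m) r}) (above r x N≤r)))
          (≈₂-reflexive (trans (+-identityˡ _) (*-zeroʳ (+ choice (suc m) r)))))
        where N≤r = ℕ.+-cancelˡ-≤ (suc m) (suc m) r 2N≤k

  steps-identity : Steps 1 (+_)
  steps-identity = record { coeff = c ; expansion = e ; below = b ; above = a }
    where
    c : ℕ → ℕ → ℤ
    c zero    x = 1ℤ
    c (suc k) x = 0ℤ
    Δ-identity : ∀ x → Δ (+_) x ≡ 1ℤ
    Δ-identity x = lemma (+ x)
      where
      lemma : ∀ a → (1ℤ + a) - a ≡ 1ℤ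
      lemma = solve-∀
    Δ^-zero : ∀ k x → Δ^ k (λ _ → 0ℤ) x ≡ 0ℤ
    Δ^-zero zero    x = refl
    Δ^-zero (suc k) x = Δ^-zero k x
    e : Expansion (Δ (+_)) c
    e zero    x = Δ-identity x
    e (suc k) x = trans (Δ^-cong k (λ y → cong₂ _-_ (Δ-identity (suc y)) (Δ-identity y)) x)
      (trans (Δ^-zero k x) (sym (*-zeroʳ (pow (suc k)))))
    b : ∀ k x → k < 1 → c k x ≈₂ 1ℤ
    b zero    x _ = ≈₂-refl
    b (suc k) x (s≤s ())
    a : ∀ k x → 1 ≤ k → c k x ≈₂ 0ℤ
    a (suc k) x _ = ≈₂-refl

  -- The indicator of the odd numbers, and the members of `B` built with it.

  χ : ℕ → ℤ
  χ zero    = 1ℤ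
  χ (suc x) = - χ x

  o : ℕ → ℤ
  o zero    = 0ℤ
  o (suc x) = 1ℤ - o x

  χ≡1-2o : ∀ x → χ x ≡ 1ℤ - + 2 * o x
  χ≡1-2o zero    = refl
  χ≡1-2o (suc x) = trans (cong -_ (χ≡1-2o x)) (lemma (o x))
    where
    lemma : ∀ a → - (1ℤ - + 2 * a) ≡ 1ℤ - + 2 * (1ℤ - a)
    lemma = solve-∀

  o-idempotent : ∀ x → o x * o x ≡ o x
  o-idempotent zero    = refl
  o-idempotent (suc x) = trans (lemma (o x))
    (trans (cong (λ y → 1ℤ - + 2 * o x + y) (o-idempotent x)) (lemma′ (o x)))
    where
    lemma : ∀ a → (1ℤ - a) * (1ℤ - a) ≡ 1ℤ - + 2 * a + a * a
    lemma = solve-∀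
    lemma′ : ∀ a → 1ℤ - + 2 * a + a ≡ 1ℤ - a
    lemma′ = solve-∀

  Δo≡χ : ∀ x → Δ o x ≡ χ x
  Δo≡χ x = trans (lemma (o x)) (sym (χ≡1-2o x))
    where
    lemma : ∀ a → 1ℤ - a - a ≡ 1ℤ - + 2 * a
    lemma = solve-∀

  χ≈₂1 : ∀ x → χ x ≈₂ 1ℤ
  χ≈₂1 zero    = ≈₂-refl
  χ≈₂1 (suc x) = ≈₂-trans (-‿≈₂ (χ x)) (χ≈₂1 x)

  -- From Δ χ = - 2 χ the k-th difference of χ is (- 2) ^ k times χ, and the sign (- 1) ^ k is χ k.
  χ-coeff : ℕ → ℕ → ℤ
  χ-coeff k x = χ k * χ x

  χ-coeff≈₂1 : ∀ k x → χ-coeff k x ≈₂ 1ℤ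
  χ-coeff≈₂1 k x = *-cong-≈₂ (χ≈₂1 k) (χ≈₂1 x)

  χ-expansion : Expansion χ χ-coeff
  χ-expansion zero    x = sym (trans (*-identityˡ _) (*-identityˡ _))
  χ-expansion (suc k) x = begin
    Δ^ k (Δ χ) x                   ≡⟨ Δ^-cong k (λ y → Δχ (χ y)) x ⟩
    Δ^ k (λ y → - + 2 * χ y) x     ≡⟨ Δ^-scale k (- + 2) χ x ⟩
    - + 2 * Δ^ k χ x               ≡⟨ cong (- + 2 *_) (χ-expansion k x) ⟩
    - + 2 * (pow k * (χ k * χ x))  ≡⟨ lemma (pow k) (χ k) (χ x) ⟩
    + 2 * pow k * (- χ k * χ x)    ≡⟨ cong (_* (- χ k * χ x)) (pow-suc k) ⟨
    pow (suc k) * (- χ k * χ x)    ∎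
    where
    open ≡-Reasoning
    Δχ : ∀ a → - a - a ≡ - + 2 * a
    Δχ = solve-∀
    lemma : ∀ p a b → - + 2 * (p * (a * b)) ≡ + 2 * p * (- a * b)
    lemma = solve-∀

  -- The expansion gives `Δ^ (suc k) f` a factor 2 ^ k. The missing 2 comes from c if k < 2 ^ L, and
  -- otherwise from the weight, since `highSum` is then positive.
  B-from-Δ : ∀ L {f c} → Expansion (Δ f) c → (∀ k x → k < 2 ℕ.^ L → c k x ≈₂ 0ℤ) → B L f
  B-from-Δ L {f} ef even zero    x = ∣ᵤ⇒∣ (ℕ.1∣ _)
  B-from-Δ L {f} {c} ef even (suc k) x with ℕ.<-≤-connex k (2 ℕ.^ L)
  ... | inj₁ k<2^L = ∣n⇒∣m*n (pow (highSum L (suc k))) (subst₂ _∣_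
    (trans (*-comm (pow k) (+ 2)) (sym (pow-suc k))) (sym (ef k x))
    (*-monoʳ-∣ (pow k) (≈₂0⇒2∣ (even k x k<2^L))))
  ... | inj₂ 2^L≤k = subst₂ _∣_ (sym (pow-suc k)) refl (*-mono-∣ 2∣pow
    (subst (pow k ∣_) (sym (ef k x)) (∣m⇒∣m*n (c k x) ∣-refl)))
    where
    2∣pow : + 2 ∣ pow (highSum L (suc k))
    2∣pow with highSum L (suc k) | highSum-positive L (suc k) (ℕ.m≤n⇒m≤1+n 2^L≤k)
    ... | suc h | _ = subst (+ 2 ∣_) (sym (pow-suc h)) (∣m⇒∣m*n (pow h) ∣-refl)

  B-twice : ∀ L {f c} → Expansion (Δ f) c → B L (twice f)
  B-twice L {f} {c} ef = B-from-Δ L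
    (expansion-cong (λ x → distrib (f (suc x)) (f x)) (expansion-scale (+ 2) ef))
    (λ k x _ → 2*≈₂0 (c k x))
    where
    distrib : ∀ a b → + 2 * (a - b) ≡ + 2 * a - + 2 * b
    distrib = solve-∀

  o-expansion : Expansion (Δ o) χ-coeff
  o-expansion = expansion-cong (λ x → sym (Δo≡χ x)) χ-expansion

  B-minus-o : ∀ L {w} → Steps (2 ℕ.^ L) w → B L (λ x → w x - o x)
  B-minus-o L {w} steps = B-from-Δ L
    (expansion-cong (λ x → distrib (w (suc x)) (w x) (o (suc x)) (o x))
      (expansion-⊕ expansion (expansion-scale (- 1ℤ) o-expansion)))
    (λ k x k< → +-cong-≈₂ (below k x k<)
      (*-cong-≈₂ (≈₂-refl { - 1ℤ}) (χ-coeff≈₂1 k x)))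
    where
    open Steps steps
    distrib : ∀ a b c d → a - b + - 1ℤ * (c - d) ≡ a - c - (b - d)
    distrib = solve-∀

  -- As 2 o = 1 - χ and χ changes sign at each step, Δ (2 z o) = Δ z + t · χ. Put N = suc m. Below N
  -- the parities are 1 + 1. Between N and 2 N = 2 ^ L the term Δ z gives 0, and t · χ gives 1 plus
  -- an odd binomial coefficient.
  B-twice-·o : ∀ L {m z} → ChoiceOdd (suc m) → 2 ℕ.^ L ≡ suc m ℕ.+ suc m → Steps (suc m) z → B L (twice (z · o))
  B-twice-·o L {m} {z} odd eq steps = B-from-Δ L
    (expansion-cong Δ[2zo] (expansion-⊕ expansion (expansion-· (t-expansion steps) χ-expansion)))
    (λ k x k< → even k x (subst (k <_) eq k<))
    where
    open Steps steps
    expand : ∀ z′ z o → z′ - z + (+ 2 * z + (z′ - z)) * (1ℤ - + 2 * o) ≡ + 2 * (z′ * (1ℤ - o)) - + 2 * (z * o)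
    expand = solve-∀
    Δ[2zo] : ∀ x → Δ z x + t steps x * χ x ≡ Δ (twice (z · o)) x
    Δ[2zo] x = trans (cong (λ y → Δ z x + t steps x * y) (χ≡1-2o x)) (expand (z (suc x)) (z x) (o x))
    even : ∀ k x → k < suc m ℕ.+ suc m → coeff k x + (τ steps ⊛ χ-coeff) k x ≈₂ 0ℤ
    even k x k<2N with ℕ.<-≤-connex k (suc m)
    ... | inj₁ k<N = ≈₂-trans (+-cong-≈₂ (below k x k<N)
        (≈₂-trans (⊛-below-peak (t-peaked steps) χ-coeff k x k<N) (χ-coeff≈₂1 k x))) 2≈₂0
    ... | inj₂ N≤k with ℕ.m≤n⇒∃[o]m+o≡n N≤k
    ... | r , refl = ≈₂-trans (+-cong-≈₂ (above _ x N≤k)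
        (≈₂-trans (⊛-above-peak (t-peaked steps) χ-coeff r x)
          (+-cong-≈₂ (χ-coeff≈₂1 (suc m ℕ.+ r) x) (*-cong-≈₂ (odd r r<N) (χ-coeff≈₂1 r x))))) 2≈₂0
        where r<N = ℕ.+-cancelˡ-< (suc m) r (suc m) k<2N

  Good : ℕ → (ℕ → ℤ) → Set
  Good L f = B L (twice f) × B L (twice (f · o))

  good-· : ∀ L f w → Good L f → B L (λ x → w x - o x) → Good L (f · w)
  good-· L f w (b , bo) bμ =
    B-cong L (λ x → expand (f x) (w x) (o x)) (B-⊕ L _ _ bo (B-· L _ _ b bμ)) ,
    B-cong L (λ x → trans (expand′ (f x) (w x) (o x)) (trans
        (cong (λ y → + 2 * (f x * o x) + + 2 * (f x * w x * o x) - + 2 * (f x * y)) (o-idempotent x))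
        (cancel (f x) (w x) (o x))))
      (B-⊕ L _ _ bo (B-· L _ _ bo bμ))
    where
    expand : ∀ f w o → + 2 * (f * o) + + 2 * f * (w - o) ≡ + 2 * (f * w)
    expand = solve-∀
    expand′ : ∀ f w o → + 2 * (f * o) + + 2 * (f * o) * (w - o)
      ≡ + 2 * (f * o) + + 2 * (f * w * o) - + 2 * (f * (o * o))
    expand′ = solve-∀
    cancel : ∀ f w o → + 2 * (f * o) + + 2 * (f * w * o) - + 2 * (f * o) ≡ + 2 * (f * w * o)
    cancel = solve-∀

-- Counting set partitions by a weighted recursion.

module SetPartitions where
  open FiniteDifferences
  open import Data.Bool.Base using (true; false; if_then_else_)
  open import Data.Fin.Base as Fin using ()
  open import Data.Fin.Subset using (Subset; inside; outside; Nonempty; ⋃; ⊤)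
  open import Data.Integer.Base as ℤ using (ℤ)
  import Data.Integer.Properties as ℤ
  import Data.Integer.Tactic.RingSolver as ℤRing
  open import Data.List.Base using (List; []; _∷_; _++_; map; filter; length)
  open import Data.List.Properties using (map-++; map-∘; map-id; map-cong; ++-identityʳ)
  open import Data.List.Relation.Unary.All using (All; []; _∷_)
  open import Data.List.Relation.Unary.AllPairs using (AllPairs; []; _∷_)
  open import Data.Nat.Base
  open import Data.Nat.ListAction using (sum)
  open import Data.Nat.ListAction.Properties using (sum-++)
  open import Data.Nat.Properties
  open import Data.Nat.Tactic.RingSolver using (solve-∀)
  open import Data.Product.Base using (_×_; _,_; proj₁; proj₂)
  open import Data.Vec.Base as Vec using ([]; _∷_; here; there)
  open import Data.Vec.Properties using (∷-injective)
  open import Function.Base using (_∘_)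
  open import Relation.Binary.PropositionalEquality
  open import Relation.Nullary using (¬_; Dec; yes; no; does; contradiction)
  open import Relation.Unary using (Decidable)

  private
    variable
      A C : Set
      n : ℕ

  ∑ : List A → (A → ℕ) → ℕ
  ∑ xs f = sum (map f xs)

  ∑-++ : ∀ (xs ys : List A) f → ∑ (xs ++ ys) f ≡ ∑ xs f + ∑ ys f
  ∑-++ xs ys f = trans (cong sum (map-++ f xs ys)) (sum-++ (map f xs) (map f ys))

  ∑-map : ∀ (xs : List A) (g : A → C) f → ∑ (map g xs) f ≡ ∑ xs (f ∘ g)
  ∑-map xs g f = cong sum (sym (map-∘ xs))

  ∑-cong : ∀ (xs : List A) {f g} → f ≗ g → ∑ xs f ≡ ∑ xs g
  ∑-cong xs f≗g = cong sum (map-cong f≗g xs)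

  ∑-zero : ∀ (xs : List A) {f} → (∀ x → f x ≡ 0) → ∑ xs f ≡ 0
  ∑-zero []       f≡0 = refl
  ∑-zero (x ∷ xs) f≡0 = cong₂ _+_ (f≡0 x) (∑-zero xs f≡0)

  ∑-*ˡ : ∀ (xs : List A) c f → ∑ xs (λ x → c * f x) ≡ c * ∑ xs f
  ∑-*ˡ []       c f = sym (*-zeroʳ c)
  ∑-*ˡ (x ∷ xs) c f = trans (cong (c * f x +_) (∑-*ˡ xs c f)) (sym (*-distribˡ-+ c (f x) _))

  length-filter≡∑ : ∀ {P : A → Set} (P? : Decidable P) (xs : List A) →
    length (filter P? xs) ≡ ∑ xs λ x → if does (P? x) then 1 else 0
  length-filter≡∑ P? []       = refl
  length-filter≡∑ P? (x ∷ xs) with does (P? x)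
  ... | true  = cong suc (length-filter≡∑ P? xs)
  ... | false = length-filter≡∑ P? xs

  choose-map : ∀ k (g : A → C) xs → choose k (map g xs) ≡ map (map g) (choose k xs)
  choose-map zero    g xs       = refl
  choose-map (suc k) g []       = refl
  choose-map (suc k) g (x ∷ xs) = begin
    map (g x ∷_) (choose k (map g xs)) ++ choose (suc k) (map g xs)
      ≡⟨ cong₂ (λ u v → map (g x ∷_) u ++ v) (choose-map k g xs) (choose-map (suc k) g xs) ⟩
    map (g x ∷_) (map (map g) (choose k xs)) ++ map (map g) (choose (suc k) xs)
      ≡⟨ cong (_++ map (map g) (choose (suc k) xs)) (trans (sym (map-∘ (choose k xs))) (map-∘ (choose k xs))) ⟩
    map (map g) (map (x ∷_) (choose k xs)) ++ map (map g) (choose (suc k) xs)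
      ≡⟨ map-++ (map g) (map (x ∷_) (choose k xs)) (choose (suc k) xs) ⟨
    map (map g) (choose (suc k) (x ∷ xs)) ∎
    where open ≡-Reasoning

  ∑-choose-zero : ∀ k (f : A → C) ψ zs → (∀ z F → ψ (f z ∷ F) ≡ 0) → ∑ (choose (suc k) (map f zs)) ψ ≡ 0
  ∑-choose-zero k f ψ []       ψ≡0 = refl
  ∑-choose-zero k f ψ (z ∷ zs) ψ≡0 = trans (∑-++ (map (f z ∷_) (choose k (map f zs))) _ ψ)
    (cong₂ _+_ (trans (∑-map (choose k (map f zs)) (f z ∷_) ψ) (∑-zero (choose k (map f zs)) (ψ≡0 z)))
      (∑-choose-zero k f ψ zs ψ≡0))

  -- Chosen sublists keep their order, so entries from `map f zs` stand adjacent at the end. With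
  -- two or more of them ψ vanishes; the two sums collect the sublists with none and with exactly
  -- one.
  ∑-choose-++ : ∀ k (xs : List C) (f : A → C) zs ψ →
    (∀ F z z′ G → ψ (F ++ f z ∷ f z′ ∷ G) ≡ 0) →
    ∑ (choose (suc k) (xs ++ map f zs)) ψ ≡
    ∑ (choose (suc k) xs) ψ + ∑ (choose k xs) (λ F → ∑ zs λ z → ψ (F ++ f z ∷ []))
  ∑-choose-++ zero [] f zs ψ ψ≡0 = trans (singletons zs) (sym (+-identityʳ _))
    where
    singletons : ∀ zs → ∑ (choose 1 (map f zs)) ψ ≡ ∑ zs λ z → ψ (f z ∷ [])
    singletons []       = refl
    singletons (z ∷ zs) = cong (ψ (f z ∷ []) +_) (singletons zs)
  ∑-choose-++ (suc k) [] f zs ψ ψ≡0 = pairs zs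
    where
    pairs : ∀ zs → ∑ (choose (suc (suc k)) (map f zs)) ψ ≡ 0
    pairs []       = refl
    pairs (z ∷ zs) = trans (∑-++ (map (f z ∷_) (choose (suc k) (map f zs))) _ ψ)
      (cong₂ _+_ (trans (∑-map (choose (suc k) (map f zs)) (f z ∷_) ψ)
          (∑-choose-zero k f (ψ ∘ (f z ∷_)) zs (ψ≡0 [] z)))
        (pairs zs))
  ∑-choose-++ zero (x ∷ xs) f zs ψ ψ≡0 =
    trans (cong (ψ (x ∷ []) +_) (∑-choose-++ zero xs f zs ψ ψ≡0)) (sym (+-assoc (ψ (x ∷ [])) _ _))
  ∑-choose-++ (suc k) (x ∷ xs) f zs ψ ψ≡0 = begin
    ∑ (map (x ∷_) (choose (suc k) (xs ++ map f zs)) ++ choose (suc (suc k)) (xs ++ map f zs)) ψ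
      ≡⟨ ∑-++ (map (x ∷_) (choose (suc k) (xs ++ map f zs))) _ ψ ⟩
    ∑ (map (x ∷_) (choose (suc k) (xs ++ map f zs))) ψ + ∑ (choose (suc (suc k)) (xs ++ map f zs)) ψ
      ≡⟨ cong₂ _+_
           (trans (∑-map (choose (suc k) (xs ++ map f zs)) (x ∷_) ψ)
             (∑-choose-++ k xs f zs (ψ ∘ (x ∷_)) (ψ≡0 ∘ (x ∷_))))
           (∑-choose-++ (suc k) xs f zs ψ ψ≡0) ⟩
    (∑ (choose (suc k) xs) (ψ ∘ (x ∷_)) + ∑ (choose k xs) (φ ∘ (x ∷_)))
      + (∑ (choose (suc (suc k)) xs) ψ + ∑ (choose (suc k) xs) φ)
      ≡⟨ interchange (∑ (choose (suc k) xs) (ψ ∘ (x ∷_))) _ _ _ ⟩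
    (∑ (choose (suc k) xs) (ψ ∘ (x ∷_)) + ∑ (choose (suc (suc k)) xs) ψ)
      + (∑ (choose k xs) (φ ∘ (x ∷_)) + ∑ (choose (suc k) xs) φ)
      ≡⟨ cong₂ _+_ (unsplit (choose (suc k) xs) (choose (suc (suc k)) xs) ψ)
                   (unsplit (choose k xs) (choose (suc k) xs) φ) ⟨
    ∑ (choose (suc (suc k)) (x ∷ xs)) ψ + ∑ (choose (suc k) (x ∷ xs)) φ ∎
    where
    open ≡-Reasoning
    φ = λ F → ∑ zs λ z → ψ (F ++ f z ∷ [])
    interchange : ∀ a b c d → (a + b) + (c + d) ≡ (a + c) + (b + d)
    interchange = solve-∀
    unsplit : ∀ Fs Gs h → ∑ (map (x ∷_) Fs ++ Gs) h ≡ ∑ Fs (h ∘ (x ∷_)) + ∑ Gs h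
    unsplit Fs Gs h = trans (∑-++ (map (x ∷_) Fs) Gs h) (cong (_+ ∑ Gs h) (∑-map Fs (x ∷_) h))

  headCount : List (Subset (suc n)) → ℕ
  headCount []                  = 0
  headCount ((inside  ∷ _) ∷ F) = suc (headCount F)
  headCount ((outside ∷ _) ∷ F) = headCount F

  headCount-++ : ∀ (F G : List (Subset (suc n))) → headCount (F ++ G) ≡ headCount F + headCount G
  headCount-++ []                  G = refl
  headCount-++ ((inside  ∷ _) ∷ F) G = cong suc (headCount-++ F G)
  headCount-++ ((outside ∷ _) ∷ F) G = headCount-++ F G

  headCount-outside : ∀ (F : List (Subset n)) → headCount (map (outside ∷_) F) ≡ 0
  headCount-outside []      = refl
  headCount-outside (_ ∷ F) = headCount-outside F

  tails : List (Subset (suc n)) → List (Subset n)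
  tails = map Vec.tail

  tails-outside : ∀ (F : List (Subset n)) → tails (map (outside ∷_) F) ≡ F
  tails-outside F = trans (sym (map-∘ F)) (map-id F)

  cover : ℕ → ℕ → ℕ
  cover x 0             = x
  cover x 1             = 1
  cover x (suc (suc _)) = 0

  cover-suc : ∀ x m → cover x m + cover x (suc m) ≡ cover (suc x) m
  cover-suc x 0             = +-comm x 1
  cover-suc x 1             = refl
  cover-suc x (suc (suc _)) = refl

  -- x to the number of uncovered points if the sets are pairwise disjoint, and 0 otherwise.
  coverWeight : ℕ → List (Subset n) → ℕ
  coverWeight {zero}  x F = 1
  coverWeight {suc n} x F = cover x (headCount F) * coverWeight x (tails F)

  -- A further set p either leaves an uncovered point uncovered, weight x, or takes it in, weight 1,
  -- and must avoid the covered points. These choices are independent, so each uncovered point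
  -- contributes x + 1.
  ∑-coverWeight : ∀ x (F : List (Subset n)) →
    ∑ (subsets n) (λ p → coverWeight x (F ++ p ∷ [])) ≡ coverWeight (suc x) F
  ∑-coverWeight {zero}  x F = refl
  ∑-coverWeight {suc n} x F = begin
    ∑ (map (outside ∷_) (subsets n) ++ map (inside ∷_) (subsets n)) w
      ≡⟨ ∑-++ (map (outside ∷_) (subsets n)) _ w ⟩
    ∑ (map (outside ∷_) (subsets n)) w + ∑ (map (inside ∷_) (subsets n)) w
      ≡⟨ cong₂ _+_ (half outside 0 λ _ → refl) (half inside 1 λ _ → refl) ⟩
    cover x (headCount F + 0) * W + cover x (headCount F + 1) * W
      ≡⟨ cong₂ (λ i j → cover x i * W + cover x j * W) (+-identityʳ (headCount F)) (+-comm (headCount F) 1) ⟩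
    cover x (headCount F) * W + cover x (suc (headCount F)) * W
      ≡⟨ *-distribʳ-+ W (cover x (headCount F)) (cover x (suc (headCount F))) ⟨
    (cover x (headCount F) + cover x (suc (headCount F))) * W
      ≡⟨ cong (_* W) (cover-suc x (headCount F)) ⟩
    coverWeight (suc x) F ∎
    where
    open ≡-Reasoning
    w = λ p → coverWeight x (F ++ p ∷ [])
    W = coverWeight (suc x) (tails F)
    half : ∀ s m → (∀ p → headCount {n} ((s ∷ p) ∷ []) ≡ m) →
      ∑ (map (s ∷_) (subsets n)) w ≡ cover x (headCount F + m) * W
    half s m head≡m = begin
      ∑ (map (s ∷_) (subsets n)) w
        ≡⟨ ∑-map (subsets n) (s ∷_) w ⟩
      ∑ (subsets n) (λ p → w (s ∷ p))
        ≡⟨ ∑-cong (subsets n) (λ p → cong₂ (λ m G → cover x m * coverWeight x G)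
             (trans (headCount-++ F _) (cong (headCount F +_) (head≡m p))) (map-++ Vec.tail F _)) ⟩
      ∑ (subsets n) (λ p → cover x (headCount F + m) * coverWeight x (tails F ++ p ∷ []))
        ≡⟨ ∑-*ˡ (subsets n) (cover x (headCount F + m)) (λ p → coverWeight x (tails F ++ p ∷ [])) ⟩
      cover x (headCount F + m) * ∑ (subsets n) (λ p → coverWeight x (tails F ++ p ∷ []))
        ≡⟨ cong (cover x (headCount F + m) *_) (∑-coverWeight x (tails F)) ⟩
      cover x (headCount F + m) * W ∎

  occupied : Subset n → ℕ
  occupied []            = 0
  occupied (inside  ∷ p) = 1
  occupied (outside ∷ p) = occupied p

  allOccupied : List (Subset n) → ℕ
  allOccupied []      = 1
  allOccupied (p ∷ F) = occupied p * allOccupied F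

  allOccupied-outside : ∀ (F G : List (Subset n)) →
    allOccupied (map (outside ∷_) F ++ map (inside ∷_) G) ≡ allOccupied F
  allOccupied-outside (p ∷ F) G       = cong (occupied p *_) (allOccupied-outside F G)
  allOccupied-outside []      []      = refl
  allOccupied-outside []      (p ∷ G) = trans (+-identityʳ _) (allOccupied-outside [] G)

  -- Summed over the k-element families this yields the r-Stirling numbers with r = x: each
  -- uncovered point joins one of x additional labelled blocks.
  weight : ℕ → List (Subset n) → ℕ
  weight x F = allOccupied F * coverWeight x F

  -- x = 0 gives the Stirling number; adjoining a point to the ground set turns x into x + 1.
  weightedS : ℕ → ℕ → ℕ → ℕ
  weightedS x n k = ∑ (choose k (subsets n)) (weight x)

  weight-outside : ∀ x (F : List (Subset n)) → weight x (map (outside ∷_) F) ≡ x * weight x F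
  weight-outside x F = begin
    allOccupied F′ * (cover x (headCount F′) * coverWeight x (tails F′))
      ≡⟨ cong₂ (λ m G → allOccupied F′ * (cover x m * coverWeight x G))
           (headCount-outside F) (tails-outside F) ⟩
    allOccupied F′ * (x * coverWeight x F)
      ≡⟨ cong (_* (x * coverWeight x F))
           (trans (cong allOccupied (sym (++-identityʳ F′))) (allOccupied-outside F [])) ⟩
    allOccupied F * (x * coverWeight x F)
      ≡⟨ lemma (allOccupied F) x (coverWeight x F) ⟩
    x * weight x F ∎
    where
    open ≡-Reasoning
    F′ = map (outside ∷_) F
    lemma : ∀ a x c → a * (x * c) ≡ x * (a * c)
    lemma = solve-∀

  weight-inside : ∀ x (F : List (Subset n)) p →
    weight x (map (outside ∷_) F ++ (inside ∷ p) ∷ []) ≡ allOccupied F * coverWeight x (F ++ p ∷ [])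
  weight-inside x F p = cong₂ _*_ (allOccupied-outside F (p ∷ []))
    (trans (cong₂ (λ m G → cover x m * coverWeight x G)
        (trans (headCount-++ (map (outside ∷_) F) _) (cong (_+ 1) (headCount-outside F)))
        (trans (map-++ Vec.tail (map (outside ∷_) F) _) (cong (_++ p ∷ []) (tails-outside F))))
      (*-identityˡ _))

  weight-two-inside : ∀ x F (p q : Subset n) G → weight x (F ++ (inside ∷ p) ∷ (inside ∷ q) ∷ G) ≡ 0
  weight-two-inside x F p q G = trans
    (cong (λ m → allOccupied all * (cover x m * coverWeight x (tails all)))
      (trans (headCount-++ F _) (trans (+-suc (headCount F) _) (cong suc (+-suc (headCount F) _)))))
    (*-zeroʳ (allOccupied all))
    where all = F ++ (inside ∷ p) ∷ (inside ∷ q) ∷ G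

  weightedS-zero : ∀ x n → weightedS x (suc n) 0 ≡ x * weightedS x n 0
  weightedS-zero x n = lemma x (coverWeight {n} x [])
    where
    lemma : ∀ x c → 1 * (x * c) + 0 ≡ x * (1 * c + 0)
    lemma = solve-∀

  -- The first point is uncovered, with factor x, or lies in a single block `inside ∷ p`. This block
  -- is nonempty for every p, so p runs over all subsets and `∑-coverWeight` turns it into x + 1.
  weightedS-suc : ∀ x n k → weightedS x (suc n) (suc k) ≡ x * weightedS x n (suc k) + weightedS (suc x) n k
  weightedS-suc x n k = begin
    ∑ (choose (suc k) (map (outside ∷_) (subsets n) ++ map (inside ∷_) (subsets n))) (weight x)
      ≡⟨ ∑-choose-++ k (map (outside ∷_) (subsets n)) (inside ∷_) (subsets n) (weight x) (weight-two-inside x) ⟩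
    ∑ (choose (suc k) (map (outside ∷_) (subsets n))) (weight x)
      + ∑ (choose k (map (outside ∷_) (subsets n))) φ
      ≡⟨ cong₂ _+_ (reindex (suc k) (weight x)) (reindex k φ) ⟩
    ∑ (choose (suc k) (subsets n)) (weight x ∘ map (outside ∷_))
      + ∑ (choose k (subsets n)) (φ ∘ map (outside ∷_))
      ≡⟨ cong₂ _+_
           (trans (∑-cong (choose (suc k) (subsets n)) (weight-outside x))
             (∑-*ˡ (choose (suc k) (subsets n)) x _))
           (∑-cong (choose k (subsets n)) absorb) ⟩
    x * weightedS x n (suc k) + weightedS (suc x) n k ∎
    where
    open ≡-Reasoning
    φ = λ F → ∑ (subsets n) λ p → weight x (F ++ (inside ∷ p) ∷ [])
    reindex : ∀ k ψ →
      ∑ (choose k (map (outside ∷_) (subsets n))) ψ ≡ ∑ (choose k (subsets n)) (ψ ∘ map (outside ∷_))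
    reindex k ψ = trans (cong (λ Fs → ∑ Fs ψ) (choose-map k (outside ∷_) (subsets n)))
      (∑-map (choose k (subsets n)) (map (outside ∷_)) ψ)
    absorb : ∀ F → φ (map (outside ∷_) F) ≡ weight (suc x) F
    absorb F = trans (∑-cong (subsets n) (weight-inside x F))
      (trans (∑-*ˡ (subsets n) (allOccupied F) _) (cong (allOccupied F *_) (∑-coverWeight x F)))

  -- Weights at x = 0 as indicators of set partitions.

  data Indicates (P : Set) : ℕ → Set where
    one  : P → Indicates P 1
    zero : ¬ P → Indicates P 0

  indicates-× : ∀ {P Q : Set} {i j} → Indicates P i → Indicates Q j → Indicates (P × Q) (i * j)
  indicates-× (one p)   (one q)   = one (p , q)
  indicates-× (one p)   (zero ¬q) = zero (¬q ∘ proj₂)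
  indicates-× (zero ¬p) _         = zero (¬p ∘ proj₁)

  indicates-map : ∀ {P Q : Set} {i} → (P → Q) → (Q → P) → Indicates P i → Indicates Q i
  indicates-map f g (one p)   = one (f p)
  indicates-map f g (zero ¬p) = zero (¬p ∘ g)

  indicates-does : ∀ {P : Set} {i} (P? : Dec P) → Indicates P i → (if does P? then 1 else 0) ≡ i
  indicates-does (yes p) (one _)   = refl
  indicates-does (yes p) (zero ¬p) = contradiction p ¬p
  indicates-does (no ¬p) (one p)   = contradiction p ¬p
  indicates-does (no ¬p) (zero _)  = refl

  occupied-indicates : ∀ (p : Subset n) → Indicates (Nonempty p) (occupied p)
  occupied-indicates []            = zero λ ()
  occupied-indicates (inside  ∷ p) = one (Fin.zero , here)
  occupied-indicates (outside ∷ p) = indicates-map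
    (λ (i , i∈p) → Fin.suc i , there i∈p) (λ { (Fin.suc i , there i∈p) → i , i∈p }) (occupied-indicates p)

  allOccupied-indicates : ∀ (F : List (Subset n)) → Indicates (All Nonempty F) (allOccupied F)
  allOccupied-indicates []      = one []
  allOccupied-indicates (p ∷ F) = indicates-map (λ (x , y) → x ∷ y) (λ { (x ∷ y) → x , y })
    (indicates-× (occupied-indicates p) (allOccupied-indicates F))

  disjoint-outsideˡ : ∀ b {p q : Subset n} → Disjoint p q → Disjoint (outside ∷ p) (b ∷ q)
  disjoint-outsideˡ b d (Fin.suc i , there i∈) = d (i , i∈)

  disjoint-outsideʳ : ∀ a {p q : Subset n} → Disjoint p q → Disjoint (a ∷ p) (outside ∷ q)
  disjoint-outsideʳ inside  d (Fin.suc i , there i∈) = d (i , i∈)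
  disjoint-outsideʳ outside d (Fin.suc i , there i∈) = d (i , i∈)

  disjoint-tails : ∀ a b {p q : Subset n} → Disjoint (a ∷ p) (b ∷ q) → Disjoint p q
  disjoint-tails a b d (i , i∈) = d (Fin.suc i , there i∈)

  allDisjoint-tails : ∀ a {p : Subset n} F → All (Disjoint (a ∷ p)) F → All (Disjoint p) (tails F)
  allDisjoint-tails a []            []       = []
  allDisjoint-tails a ((b ∷ q) ∷ F) (d ∷ ds) = disjoint-tails a b d ∷ allDisjoint-tails a F ds

  allDisjoint-inside : ∀ {p : Subset n} F → All (Disjoint (inside ∷ p)) F → headCount F ≡ 0
  allDisjoint-inside []                  []       = refl
  allDisjoint-inside ((inside  ∷ q) ∷ F) (d ∷ ds) = contradiction (Fin.zero , here) d
  allDisjoint-inside ((outside ∷ q) ∷ F) (d ∷ ds) = allDisjoint-inside F ds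

  outside-allDisjoint : ∀ {p : Subset n} F → All (Disjoint p) (tails F) → All (Disjoint (outside ∷ p)) F
  outside-allDisjoint []            []       = []
  outside-allDisjoint ((b ∷ q) ∷ F) (d ∷ ds) = disjoint-outsideˡ b d ∷ outside-allDisjoint F ds

  inside-allDisjoint : ∀ {p : Subset n} F → headCount F ≡ 0 →
    All (Disjoint p) (tails F) → All (Disjoint (inside ∷ p)) F
  inside-allDisjoint []                  _  []       = []
  inside-allDisjoint ((outside ∷ q) ∷ F) eq (d ∷ ds) = disjoint-outsideʳ inside d ∷ inside-allDisjoint F eq ds

  pairwise-tails : ∀ (F : List (Subset (suc n))) → AllPairs Disjoint F →
    headCount F ≤ 1 × AllPairs Disjoint (tails F)
  pairwise-tails []                  []       = z≤n , []
  pairwise-tails ((inside  ∷ p) ∷ F) (d ∷ ds) = s≤s (≤-reflexive (allDisjoint-inside F d)) ,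
    allDisjoint-tails inside F d ∷ proj₂ (pairwise-tails F ds)
  pairwise-tails ((outside ∷ p) ∷ F) (d ∷ ds) = proj₁ (pairwise-tails F ds) ,
    allDisjoint-tails outside F d ∷ proj₂ (pairwise-tails F ds)

  tails-pairwise : ∀ (F : List (Subset (suc n))) → headCount F ≤ 1 →
    AllPairs Disjoint (tails F) → AllPairs Disjoint F
  tails-pairwise []                  _        []       = []
  tails-pairwise ((inside  ∷ p) ∷ F) (s≤s le) (d ∷ ds) =
    inside-allDisjoint F (n≤0⇒n≡0 le) d ∷ tails-pairwise F (≤-trans le z≤n) ds
  tails-pairwise ((outside ∷ p) ∷ F) le       (d ∷ ds) =
    outside-allDisjoint F d ∷ tails-pairwise F le ds

  ⋃-∷ : ∀ (F : List (Subset (suc n))) → ⋃ F ≡ (0 <ᵇ headCount F) ∷ ⋃ (tails F)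
  ⋃-∷ []                  = refl
  ⋃-∷ ((inside  ∷ p) ∷ F) rewrite ⋃-∷ F = refl
  ⋃-∷ ((outside ∷ p) ∷ F) rewrite ⋃-∷ F = refl

  PairwiseCover : List (Subset n) → Set
  PairwiseCover F = AllPairs Disjoint F × ⋃ F ≡ ⊤

  -- At x = 0 an uncovered point has weight 0, so a nonzero weight forces each point into exactly
  -- one set. Disjointness and covering are thus tested together, point by point.
  coverWeight-indicates : ∀ (F : List (Subset n)) → Indicates (PairwiseCover F) (coverWeight 0 F)
  coverWeight-indicates {zero} F = one (pairwise F , unique (⋃ F))
    where
    unique : ∀ (p : Subset 0) → p ≡ ⊤
    unique [] = refl
    allDisjoint : ∀ {p : Subset 0} F → All (Disjoint p) F
    allDisjoint []      = []
    allDisjoint (q ∷ F) = (λ ()) ∷ allDisjoint F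
    pairwise : ∀ (F : List (Subset 0)) → AllPairs Disjoint F
    pairwise []      = []
    pairwise (p ∷ F) = allDisjoint F ∷ pairwise F
  coverWeight-indicates {suc n} F = indicates-map to from
    (indicates-× (cover-indicates (headCount F)) (coverWeight-indicates (tails F)))
    where
    cover-indicates : ∀ m → Indicates (m ≡ 1) (cover 0 m)
    cover-indicates 0             = zero λ ()
    cover-indicates 1             = one refl
    cover-indicates (suc (suc m)) = zero λ ()
    to : headCount F ≡ 1 × PairwiseCover (tails F) → PairwiseCover F
    to (eq , ds , ⋃≡⊤) = tails-pairwise F (≤-reflexive eq) ds ,
      trans (⋃-∷ F) (cong₂ _∷_ (cong (0 <ᵇ_) eq) ⋃≡⊤)
    from : PairwiseCover F → headCount F ≡ 1 × PairwiseCover (tails F)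
    from (ds , ⋃≡⊤) with ∷-injective (trans (sym (⋃-∷ F)) ⋃≡⊤)
    ... | head≡ , tails≡ = ≤-antisym (proj₁ (pairwise-tails F ds)) (positive (headCount F) head≡) ,
      proj₂ (pairwise-tails F ds) , tails≡
      where
      positive : ∀ m → (0 <ᵇ m) ≡ true → 1 ≤ m
      positive (suc m) _ = s≤s z≤n

  S≡weightedS : ∀ n k → S n k ≡ weightedS 0 n k
  S≡weightedS n k = trans (length-filter≡∑ isPartition? (choose k (subsets n)))
    (∑-cong (choose k (subsets n)) λ F → indicates-does (isPartition? F)
      (indicates-× (allOccupied-indicates F) (coverWeight-indicates F)))

  weightedS-positive : ∀ x n k → k ≤ n → 0 < weightedS (suc x) n k
  weightedS-positive x zero    zero    _         = s≤s z≤n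
  weightedS-positive x (suc n) zero    _         =
    subst (0 <_) (sym (weightedS-zero (suc x) n)) (≤-trans (weightedS-positive x n 0 z≤n) (m≤m+n _ _))
  weightedS-positive x (suc n) (suc k) (s≤s k≤n) =
    subst (0 <_) (sym (weightedS-suc (suc x) n k)) (≤-trans (weightedS-positive (suc x) n k k≤n) (m≤n+m _ _))

  -- Required because `ν₂ 0` is 0 by convention. At x = 0 the recursion leaves only the summand with
  -- x = 1, where positivity passes from one summand to the sum.
  S-positive : ∀ n k → 0 < k → k ≤ n → 0 < S n k
  S-positive (suc n) (suc k) _ (s≤s k≤n) =
    subst (0 <_) (sym (trans (S≡weightedS (suc n) (suc k)) (weightedS-suc 0 n k)))
      (weightedS-positive 0 n k k≤n)

  -- The Leibniz rule for the factor x, whose differences of order at least two vanish, so that two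
  -- terms remain.
  Δ^-identity· : ∀ k f x →
    Δ^ (suc k) (ℤ.+_ · f) x ≡ ℤ.+ x ℤ.* Δ^ (suc k) f x ℤ.+ ℤ.+ suc k ℤ.* Δ^ k f (suc x)
  Δ^-identity· zero f x = lemma (ℤ.+ x) (f (suc x)) (f x)
    where
    lemma : ∀ x a b → (ℤ.1ℤ ℤ.+ x) ℤ.* a ℤ.- x ℤ.* b ≡ x ℤ.* (a ℤ.- b) ℤ.+ ℤ.1ℤ ℤ.* a
    lemma = ℤRing.solve-∀
  Δ^-identity· (suc k) f x = begin
    Δ^ (suc k) (Δ (ℤ.+_ · f)) x
      ≡⟨ Δ^-cong (suc k) (λ y → product (ℤ.+ y) (f (suc y)) (f y)) x ⟩
    Δ^ (suc k) ((ℤ.+_ · Δ f) ⊕ (f ∘ suc)) x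
      ≡⟨ Δ^-⊕ (suc k) (ℤ.+_ · Δ f) (f ∘ suc) x ⟩
    Δ^ (suc k) (ℤ.+_ · Δ f) x ℤ.+ Δ^ (suc k) (f ∘ suc) x
      ≡⟨ cong₂ ℤ._+_ (Δ^-identity· k (Δ f) x) (Δ^-shift (suc k) f x) ⟩
    ℤ.+ x ℤ.* Δ^ (suc (suc k)) f x ℤ.+ ℤ.+ suc k ℤ.* Δ^ (suc k) f (suc x) ℤ.+ Δ^ (suc k) f (suc x)
      ≡⟨ collect (ℤ.+ x ℤ.* Δ^ (suc (suc k)) f x) (ℤ.+ suc k) (Δ^ (suc k) f (suc x)) ⟩
    ℤ.+ x ℤ.* Δ^ (suc (suc k)) f x ℤ.+ ℤ.+ suc (suc k) ℤ.* Δ^ (suc k) f (suc x) ∎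
    where
    open ≡-Reasoning
    product : ∀ x a b → (ℤ.1ℤ ℤ.+ x) ℤ.* a ℤ.- x ℤ.* b ≡ x ℤ.* (a ℤ.- b) ℤ.+ a
    product = ℤRing.solve-∀
    collect : ∀ u k a → u ℤ.+ k ℤ.* a ℤ.+ a ≡ u ℤ.+ (ℤ.1ℤ ℤ.+ k) ℤ.* a
    collect = ℤRing.solve-∀

  power : ℕ → ℕ → ℤ
  power n x = ℤ.+ (x ^ n)

  -- `Δ^-identity·` and `weightedS-suc` are the same recursion, with the argument x in the role of
  -- the weight; the factors suc k accumulate to k !. Only x = 0 concerns `S`, but the recursion
  -- passes from x to x + 1.
  Δ^-power : ∀ n k x → Δ^ k (power n) x ≡ ℤ.+ (k ! * weightedS x n k)
  Δ^-power zero    zero          x = refl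
  Δ^-power zero    (suc k)       x = trans (Δ^-zero k)
    (cong ℤ.+_ (sym (trans (cong (suc k ! *_) (empty k)) (*-zeroʳ (suc k !)))))
    where
    Δ^-zero : ∀ k {x} → Δ^ k (λ _ → ℤ.0ℤ) x ≡ ℤ.0ℤ
    Δ^-zero zero    = refl
    Δ^-zero (suc k) = Δ^-zero k
    empty : ∀ k → weightedS x 0 (suc k) ≡ 0
    empty zero    = refl
    empty (suc k) = refl
  Δ^-power (suc n) zero    x = begin
    ℤ.+ (x * x ^ n)                      ≡⟨ ℤ.pos-* x (x ^ n) ⟩
    ℤ.+ x ℤ.* ℤ.+ (x ^ n)                ≡⟨ cong (ℤ.+ x ℤ.*_) (Δ^-power n 0 x) ⟩
    ℤ.+ x ℤ.* ℤ.+ (1 * weightedS x n 0)  ≡⟨ ℤ.pos-* x (1 * weightedS x n 0) ⟨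
    ℤ.+ (x * (1 * weightedS x n 0))      ≡⟨ cong ℤ.+_ (swap x (weightedS x n 0)) ⟩
    ℤ.+ (1 * (x * weightedS x n 0))      ≡⟨ cong (λ m → ℤ.+ (1 * m)) (weightedS-zero x n) ⟨
    ℤ.+ (1 * weightedS x (suc n) 0)      ∎
    where
    open ≡-Reasoning
    swap : ∀ x w → x * (1 * w) ≡ 1 * (x * w)
    swap = solve-∀
  Δ^-power (suc n) (suc k) x = begin
    Δ^ (suc k) (power (suc n)) x
      ≡⟨ Δ^-cong (suc k) (λ y → ℤ.pos-* y (y ^ n)) x ⟩
    Δ^ (suc k) (ℤ.+_ · power n) x
      ≡⟨ Δ^-identity· k (power n) x ⟩
    ℤ.+ x ℤ.* Δ^ (suc k) (power n) x ℤ.+ ℤ.+ suc k ℤ.* Δ^ k (power n) (suc x)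
      ≡⟨ cong₂ (λ a b → ℤ.+ x ℤ.* a ℤ.+ ℤ.+ suc k ℤ.* b) (Δ^-power n (suc k) x) (Δ^-power n k (suc x)) ⟩
    ℤ.+ x ℤ.* ℤ.+ (suc k ! * w) ℤ.+ ℤ.+ suc k ℤ.* ℤ.+ (k ! * v)
      ≡⟨ cong₂ ℤ._+_ (ℤ.pos-* x (suc k ! * w)) (ℤ.pos-* (suc k) (k ! * v)) ⟨
    ℤ.+ (x * (suc k ! * w) + suc k * (k ! * v))
      ≡⟨ cong ℤ.+_ (factor x (suc k) (k !) w v) ⟩
    ℤ.+ (suc k ! * (x * w + v))
      ≡⟨ cong (λ m → ℤ.+ (suc k ! * m)) (weightedS-suc x n k) ⟨
    ℤ.+ (suc k ! * weightedS x (suc n) (suc k)) ∎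
    where
    open ≡-Reasoning
    w = weightedS x n (suc k)
    v = weightedS (suc x) n k
    factor : ∀ x s f w v → x * (s * f * w) + s * (f * v) ≡ s * f * (x * w + v)
    factor = solve-∀

-- Odd powers of x ^ (2 ^ n), and the bound on the valuation.

open import Data.Nat.Base using (ℕ; _+_; _*_; _∸_; _^_; _≤_; _<_; _≥_)
open import Data.Nat.Divisibility using (_∤_)
open import Data.Fin.Base using (zero; suc)
import Data.Integer.Base as ℤ
import Data.Integer.Divisibility.Signed as ℤ
import Data.Integer.Properties as ℤ
open import Data.Nat.Base using (zero; suc; z≤n; s≤s; s≤s⁻¹; _!)
open import Data.Nat.Divisibility hiding (_∤_)
open import Data.Nat.Properties
open import Data.Nat.Tactic.RingSolver using (solve-∀)
open import Data.Product.Base using (_,_; proj₁)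
open import Data.Sum.Base using (inj₁; inj₂)
open import Relation.Binary.PropositionalEquality
open import Relation.Nullary using (contradiction; yes; no)
open BinaryDigits
open FiniteDifferences
open SetPartitions

maxExponent-greatest : ∀ bound {e m} → e ≤ bound → 2 ^ e ∣ m → e ≤ maxExponent bound m
maxExponent-greatest zero        e≤b _ = e≤b
maxExponent-greatest (suc bound) {e} {m} e≤b d with 2 ^ suc bound ∣? m
... | yes _ = e≤b
... | no ¬d with m≤n⇒m<n∨m≡n e≤b
...   | inj₁ e<b  = maxExponent-greatest bound (s≤s⁻¹ e<b) d
...   | inj₂ refl = contradiction d ¬d

n<2^n : ∀ n → n < 2 ^ n
n<2^n zero    = s≤s z≤n
n<2^n (suc n) = ≤-trans (+-mono-≤ (m^n>0 2 n) (n<2^n n))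
  (≤-reflexive (cong (2 ^ n +_) (sym (+-identityʳ (2 ^ n)))))

ν₂-greatest : ∀ {e m} → 0 < m → 2 ^ e ∣ m → e ≤ ν₂ m
ν₂-greatest {e} {m@(suc _)} _ d = maxExponent-greatest m (<⇒≤ (<-≤-trans (n<2^n e) (∣⇒≤ d))) d

2^suc≡2^+2^ : ∀ n → 2 ^ suc n ≡ 2 ^ n + 2 ^ n
2^suc≡2^+2^ n = cong (2 ^ n +_) (+-identityʳ (2 ^ n))

choiceOdd-pow : ∀ n → ChoiceOdd (2 ^ n)
choiceOdd-pow n r r<2^n with choice-odd n r r<2^n
... | u , eq = congruent (ℤ.divides (ℤ.+ u) (trans (cong (λ c → ℤ.+ c ℤ.- ℤ.1ℤ) eq) (ℤ.pos-* u 2)))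

steps-cong : ∀ {N z w} → z ≗ w → Steps N z → Steps N w
steps-cong z≗w steps = record
  { coeff     = coeff
  ; expansion = expansion-cong (λ x → cong₂ ℤ._-_ (z≗w (suc x)) (z≗w x)) expansion
  ; below     = below
  ; above     = above
  }
  where open Steps steps

-- Matching on N bridges the gap between 2 ^ n, which is not literally a successor, and the index
-- suc m of `steps-square`.
steps-double : ∀ N {z} → 0 < N → ChoiceOdd N → Steps N z → Steps (N + N) (z · z)
steps-double (suc m) _ odd steps = steps-square steps odd

power-· : ∀ m n → power m · power n ≗ power (m + n)
power-· m n x = trans (sym (ℤ.pos-* (x ^ m) (x ^ n))) (cong ℤ.+_ (sym (^-distribˡ-+-* x m n)))

steps-power : ∀ n → Steps (2 ^ n) (power (2 ^ n))
steps-power zero    = steps-cong (λ x → cong ℤ.+_ (sym (*-identityʳ x))) steps-identity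
steps-power (suc n) = steps-cong
  (λ x → trans (power-· (2 ^ n) (2 ^ n) x) (cong (λ e → power e x) (sym (2^suc≡2^+2^ n))))
  (subst (λ N → Steps N (power (2 ^ n) · power (2 ^ n))) (sym (2^suc≡2^+2^ n))
    (steps-double (2 ^ n) (m^n>0 2 n) (choiceOdd-pow n) (steps-power n)))

good-start : ∀ n → Good (suc n) (power (2 ^ n))
good-start n = B-twice (suc n) {power (2 ^ n)} (Steps.expansion (steps-power n)) ,
  twice-·o (2 ^ n) (m^n>0 2 n) (choiceOdd-pow n) (2^suc≡2^+2^ n) (steps-power n)
  where
  twice-·o : ∀ N {z} → 0 < N → ChoiceOdd N → 2 ^ suc n ≡ N + N → Steps N z → B (suc n) (twice (z · o))
  twice-·o (suc m) _ = B-twice-·o (suc n)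

good-cong : ∀ L {f g} → f ≗ g → Good L f → Good L g
good-cong L f≗g (b , bo) =
  B-cong L (λ x → cong (ℤ.+ 2 ℤ.*_) (f≗g x)) b ,
  B-cong L (λ x → cong (λ y → ℤ.+ 2 ℤ.* (y ℤ.* o x)) (f≗g x)) bo

good-power : ∀ n m → Good (suc n) (power ((1 + m * 2) * 2 ^ n))
good-power n zero    = good-cong (suc n) (λ x → cong (λ e → power e x) (sym (*-identityˡ (2 ^ n))))
  (good-start n)
good-power n (suc m) = good-cong (suc n)
  (λ x → trans (power-· ((1 + m * 2) * 2 ^ n) (2 ^ suc n) x) (cong (λ e → power e x) (exponent m (2 ^ n))))
  (good-· (suc n) (power ((1 + m * 2) * 2 ^ n)) (power (2 ^ suc n)) (good-power n m)
    (B-minus-o (suc n) (steps-power (suc n))))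
  where
  exponent : ∀ m p → (1 + m * 2) * p + 2 * p ≡ (1 + suc m * 2) * p
  exponent = solve-∀

-- Membership in `B` is read at x = 0 and multiplied by 2 ^ σ k, which by `legendre` replaces k ! by
-- 2 ^ k * q. Cancelling 2 ^ k and the odd q leaves 2 ^ σ k dividing 2 ^ σ b * (2 * s), and σ k = σ
-- b + σ a.
B-power⇒∣S : ∀ L N b a → a < 2 ^ L → B L (twice (power N)) →
  2 ^ σ a ∣ 2 * S N (b * 2 ^ L + a)
B-power⇒∣S L N b a a<2^L inB with legendre (b * 2 ^ L + a)
... | q , odd-q , eq = *-cancelˡ-∣ (2 ^ σ b) {{m^n≢0 2 (σ b)}}
  (subst₂ _∣_ (trans (cong (2 ^_) (σ-split L b a a<2^L)) (^-distribˡ-+-* 2 (σ b) (σ a)))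
    (cong (λ h → 2 ^ h * (2 * s)) (highSum-split L b a a<2^L))
    (odd-cancel-∣ (σ k) (2 ^ h * (2 * s)) odd-q
      (*-cancelˡ-∣ (2 ^ k) {{m^n≢0 2 k}} (subst₂ _∣_ (*-comm (2 ^ σ k) (2 ^ k)) regroup
        (*-monoʳ-∣ (2 ^ σ k) k!S)))))
  where
  open ≡-Reasoning
  k = b * 2 ^ L + a
  s = S N k
  h = highSum L k
  Δ≡ : pow h ℤ.* Δ^ k (twice (power N)) 0 ≡ ℤ.+ (2 ^ h * (2 * (k ! * s)))
  Δ≡ = begin
    pow h ℤ.* Δ^ k (twice (power N)) 0
      ≡⟨ cong (pow h ℤ.*_) (Δ^-scale k (ℤ.+ 2) (power N) 0) ⟩
    pow h ℤ.* (ℤ.+ 2 ℤ.* Δ^ k (power N) 0)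
      ≡⟨ cong (λ y → pow h ℤ.* (ℤ.+ 2 ℤ.* y))
         (trans (Δ^-power N k 0) (cong (λ y → ℤ.+ (k ! * y)) (sym (S≡weightedS N k)))) ⟩
    pow h ℤ.* (ℤ.+ 2 ℤ.* ℤ.+ (k ! * s))
      ≡⟨ cong (pow h ℤ.*_) (ℤ.pos-* 2 (k ! * s)) ⟨
    pow h ℤ.* ℤ.+ (2 * (k ! * s))
      ≡⟨ ℤ.pos-* (2 ^ h) (2 * (k ! * s)) ⟨
    ℤ.+ (2 ^ h * (2 * (k ! * s))) ∎
  k!S : 2 ^ k ∣ 2 ^ h * (2 * (k ! * s))
  k!S = ℤ.∣⇒∣ᵤ (subst (pow k ℤ.∣_) Δ≡ (inB k 0))
  left : ∀ x y f s → x * (y * (2 * (f * s))) ≡ x * f * (y * (2 * s))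
  left = solve-∀
  right : ∀ p q y s → p * q * (y * (2 * s)) ≡ p * (y * (2 * s) * q)
  right = solve-∀
  regroup : 2 ^ σ k * (2 ^ h * (2 * (k ! * s))) ≡ 2 ^ k * (2 ^ h * (2 * s) * q)
  regroup = trans (left (2 ^ σ k) (2 ^ h) (k !) s)
    (trans (cong (_* (2 ^ h * (2 * s))) eq) (right (2 ^ k) q (2 ^ h) s))

odd-witness : ∀ c → 2 ∤ c → Odd c
odd-witness c 2∤c with halve c
... | zero     , m , refl = contradiction (n∣m*n m) 2∤c
... | suc zero , m , refl = m , refl

half-∣ : ∀ e {s} → 2 ^ e ∣ 2 * s → 2 ^ (e ∸ 1) ∣ s
half-∣ zero    _ = 1∣ _
half-∣ (suc e) d = *-cancelˡ-∣ 2 d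

theorem1p1 : (n a b c : ℕ) → 0 < a → a < 2 ^ (n + 1) → b * 2 ^ (n + 1) + a ≤ c * 2 ^ n → c ≥ 1 → 2 ∤ c →
    ν₂ (S (c * 2 ^ n) (b * 2 ^ (n + 1) + a)) ≥ s₂ a ∸ 1
theorem1p1 n a b c 0<a a<2^ k≤ _ 2∤c with odd-witness c 2∤c
... | m , refl = ν₂-greatest (S-positive N k (≤-trans 0<a (m≤n+m a (b * 2 ^ (n + 1)))) k≤)
  (subst (λ e → 2 ^ (e ∸ 1) ∣ S N k) (σ≡s₂ a) (half-∣ (σ a)
    (B-power⇒∣S (n + 1) N b a a<2^
      (subst (λ L → B L (twice (power N))) (+-comm 1 n) (proj₁ (good-power n m))))))
  where
  N = (1 + m * 2) * 2 ^ n
  k = b * 2 ^ (n + 1) + a
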